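{- For any shape $S\in\mathcal C_k$ on $n$ nodes, the adjacency closure $AC(S)$ can be grown from a single node in $O(k\log n)$ time steps by a cycle-preserving growth process in the adjacency graph model.
   Context: Shapes. Grid points are integer pairs $(x,y)$; two grid points are adjacent if they are at orthogonal (Manhattan) distance $1$. A shape $S=(V,E)$ is a finite connected graph whose nodes occupy distinct grid points and whose edges join only pairs of nodes occupying adjacent points; shapes are considered up to translation, and $n=|V|$. The adjacency closure $AC(S)$ is obtained from $S$ by adding an edge between every pair of adjacent nodes that are not yet joined. Growth operations. One node, the anchor $u_0$, is stationary; other nodes move relative to it. A growth operation on a node $u$ toward an adjacent grid point $p$ either (i) if $u$ has no edge to $p$, creates a new node $u'$ at $p$ with edge $uu'$; or (ii) if $p$ is occupied by a node $v$ with $uv\in E$, creates a new node $u'$ at $p$, replaces edge $uv$ by edges $uu',u'v$, and translates by one unit, along the axis of $uv$, the part of a spanning tree rooted at $u_0$ hanging from whichever of $u,v$ is farther from $u_0$, away from the other endpoint. In one time step a set of operations is applied concurrently, each node receiving at most one operation and all operations having the same cardinal direction; the displacement of each node is the sum of the unit vectors contributed by the operations on its path to $u_0$ in a spanning tree rooted at $u_0$. The set is collision-free if no two nodes collide during these motions or end at the same point, and for every cycle and every two of its nodes the displacements accumulated along the two paths of the cycle between them are equal. Growth processes. A cycle-preserving growth process in the adjacency graph model starts from an initial shape $S_1^b=S_0$ and in each time step $t$ applies a collision-free set of growth operations to $S_t^b$ (deleting no edges), obtaining $S_t^e$, and then sets $S_{t+1}^b=AC(S_t^e)$. It grows $S$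 in $t_f$ steps if the shape after step $t_f$ is $S$. $\mathcal C_k$ is the class of shapes having a rooted spanning tree in which every root-to-leaf path has at most $k$ turns (nodes at which the path makes a right angle).
   Formalization: The bound is proved as a constant times max(k,1)·⌈log₂ n⌉: for k = 0 the literal factor k would allow no time steps, yet a straight line on n ≥ 2 nodes lies in C_0 and needs at least log₂ n steps; for k ≥ 1 the bound is exactly O(k log n). -}

module Defs where

open import Level using (0ℓ; suc)
open import Data.Bool using (Bool; T; _∧_; if_then_else_)
open import Data.Integer as ℤ using (ℤ; +_; -[1+_]; ∣_∣)
open import Data.Integer.Properties as ℤₚ using ()
open import Data.List using (List; []; _∷_; length)
open import Data.List.Membership.Propositional using (_∈_)
open import Data.List.Relation.Unary.All using ([])
open import Data.List.Relation.Unary.Any using (here)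
open import Data.List.Relation.Unary.AllPairs using ([]; _∷_)
open import Data.List.Relation.Unary.Unique.Propositional using (Unique)
open import Data.Nat as ℕ using (ℕ; zero; _≤_; _<_)
open import Data.Product using (Σ; ∃; _×_; _,_)
open import Data.Product.Properties using (≡-dec)
open import Data.Sum using (_⊎_; inj₁; inj₂)
open import Function.Bundles using (_⇔_)
open import Relation.Binary.Core using (Rel)
open import Relation.Binary.Definitions using (Symmetric; DecidableEquality)
open import Relation.Binary.Construct.Closure.ReflexiveTransitive as Star using (Star; ε; _◅_; _◅◅_)
open import Relation.Binary.Construct.Closure.Symmetric using (SymClosure)
open import Relation.Binary.PropositionalEquality using (_≡_; _≢_; refl; trans; cong₂)
open import Relation.Nullary using (¬_; does)

Point : Set
Point = ℤ × ℤ

_≟ₚ_ : DecidableEquality Point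
_≟ₚ_ = ≡-dec ℤ._≟_ ℤ._≟_

𝟎 : Point
𝟎 = + 0 , + 0

infixl 6 _⊕_ _⊖_
infixr 7 _·_

_⊕_ _⊖_ : Point → Point → Point
(x , y) ⊕ (x′ , y′) = x ℤ.+ x′ , y ℤ.+ y′
(x , y) ⊖ (x′ , y′) = x ℤ.- x′ , y ℤ.- y′

_·_ : ℕ → Point → Point
n · (x , y) = + n ℤ.* x , + n ℤ.* y

dot : Point → Point → ℤ
dot (x , y) (x′ , y′) = x ℤ.* x′ ℤ.+ y ℤ.* y′

Adjacent : Rel Point 0ℓ
Adjacent (x , y) (x′ , y′) = ∣ x ℤ.- x′ ∣ ℕ.+ ∣ y ℤ.- y′ ∣ ≡ 1

Adjacent-sym : Symmetric Adjacent
Adjacent-sym {x , y} {x′ , y′} =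
  trans (cong₂ ℕ._+_ (ℤₚ.∣i-j∣≡∣j-i∣ x′ x) (ℤₚ.∣i-j∣≡∣j-i∣ y′ y))

data Direction : Set where
  north east south west : Direction

unit : Direction → Point
unit north = + 0 , + 1
unit east  = + 1 , + 0
unit south = + 0 , -[1+ 0 ]
unit west  = -[1+ 0 ] , + 0

-- Nodes occupy distinct grid points, so a node is identified with the
-- point it occupies.
record Shape : Set (suc 0ℓ) where
  field
    nodes     : List Point
    distinct  : Unique nodes
    Edge      : Rel Point 0ℓ
    edge-sym  : Symmetric Edge
    edge-node : ∀ {p q} → Edge p q → p ∈ nodes
    edge-adj  : ∀ {p q} → Edge p q → Adjacent p q
    connected : ∀ {p q} → p ∈ nodes → q ∈ nodes → Star Edge p q

open Shape public

size : Shape → ℕ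
size S = length (nodes S)

infix 4 _≅_

_≅_ : Shape → Shape → Set
A ≅ B = ∃ λ (v : Point) →
    (∀ p → p ∈ nodes A ⇔ (p ⊕ v) ∈ nodes B)
  × (∀ p q → Edge A p q ⇔ Edge B (p ⊕ v) (q ⊕ v))

AC : Shape → Shape
AC S = record
  { nodes     = nodes S
  ; distinct  = distinct S
  ; Edge      = λ p q → Edge S p q ⊎ (p ∈ nodes S × q ∈ nodes S × Adjacent p q)
  ; edge-sym  = λ { (inj₁ e) → inj₁ (edge-sym S e)
                  ; {p} {q} (inj₂ (p∈ , q∈ , a)) → inj₂ (q∈ , p∈ , Adjacent-sym {p} {q} a) }
  ; edge-node = λ { (inj₁ e) → edge-node S e ; (inj₂ (p∈ , _)) → p∈ }
  ; edge-adj  = λ { (inj₁ e) → edge-adj S e ; (inj₂ (_ , _ , a)) → a }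
  ; connected = λ p∈ q∈ → Star.map inj₁ (connected S p∈ q∈)
  }

data NoEdge : Rel Point 0ℓ where

singleNode : Point → Shape
singleNode p = record
  { nodes     = p ∷ []
  ; distinct  = [] ∷ []
  ; Edge      = NoEdge
  ; edge-sym  = λ ()
  ; edge-node = λ ()
  ; edge-adj  = λ ()
  ; connected = λ { (here refl) (here refl) → ε }
  }

module _ {R : Rel Point 0ℓ} where

  vertices : ∀ {u v} → Star R u v → List Point
  vertices {u} ε       = u ∷ []
  vertices {u} (_ ◅ p) = u ∷ vertices p

  -- All vertices but the last one.
  sources : ∀ {u v} → Star R u v → List Point
  sources     ε       = []
  sources {u} (_ ◅ p) = u ∷ sources p

  IsCycle : ∀ {u} → Star R u u → Set
  IsCycle c = Unique (sources c) × 3 ≤ length (sources c)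

-- Number of inner vertices b, with predecessor a and successor c, at
-- which the steps a→b and b→c are perpendicular.
turns : List Point → ℕ
turns (a ∷ b ∷ c ∷ ps) =
  (if does (dot (b ⊖ a) (c ⊖ b) ℤ.≟ + 0) then 1 else 0) ℕ.+ turns (b ∷ c ∷ ps)
turns _ = 0

-- A rooted tree is given by its parent map.  The value of parent at the
-- root and outside the node set is irrelevant.  As Child x w determines x
-- from w and nothing has the root as child, each walk along Child from the
-- root is the unique tree path to its endpoint.
record SpanningTree (S : Shape) (root : Point) : Set where
  field
    parent : Point → Point

  Child : Rel Point 0ℓ
  Child x w = w ∈ nodes S × w ≢ root × parent w ≡ x

  field
    root-node  : root ∈ nodes S
    child-edge : ∀ {x w} → Child x w → Edge S x w
    path       : ∀ {w} → w ∈ nodes S → Star Child root w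

  Leaf : Point → Set
  Leaf w = ∀ x → ¬ Child w x

𝒞 : ℕ → Shape → Set
𝒞 k S = ∃ λ root → Σ (SpanningTree S root) λ tree →
  let open SpanningTree tree in
  ∀ {w} (p : Star Child root w) → Leaf w → turns (vertices p) ≤ k

-- All operations of a step share a direction and each node receives at
-- most one, so the set of operations is the set of nodes that receive one.
module Operations (A : Shape) (d : Direction) (receives : Point → Bool) where

  -- For an edge uv: the operation on u, if any, is directed at v and hence
  -- replaces uv by uu′ and u′v.
  split : Point → Point → Bool
  split u v = receives u ∧ does ((u ⊕ unit d) ≟ₚ v)

  -- What the edge uv, traversed from u to v, contributes to the
  -- displacement of v relative to u.
  contribution : Point → Point → Point
  contribution u v =
    (if split u v then unit d else 𝟎) ⊖ (if split v u then unit d else 𝟎)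

  displacement : ∀ {R : Rel Point 0ℓ} {u v} → Star R u v → Point
  displacement ε                   = 𝟎
  displacement (_◅_ {u} {v} _ p) = contribution u v ⊕ displacement p

  -- A cycle through u and v is split at v into p and q; the two paths from
  -- u to v are p and the reversal of q.
  CycleConsistent : Set
  CycleConsistent = ∀ {u v} (p : Star (Edge A) u v) (q : Star (Edge A) v u) →
    IsCycle (p ◅◅ q) → displacement p ≡ displacement (Star.reverse (edge-sym A) q)

  -- δ w is the displacement of node w.
  module Result (δ : Point → Point) where

    moved : Point → Point
    moved w = w ⊕ δ w

    -- Final position of the node created by the operation on u.  In the
    -- splitting case the neighbour v = u ⊕ unit d ends at
    -- moved u ⊕ 2 · unit d, so the new node lies between the two.
    created : Point → Point
    created u = moved u ⊕ unit d

    data NewNode : Point → Set where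
      old : ∀ {w} → w ∈ nodes A → NewNode (moved w)
      new : ∀ {u} → T (receives u) → NewNode (created u)

    -- Each undirected edge is listed in one orientation at least.
    data NewEdge : Rel Point 0ℓ where
      kept  : ∀ {u v} → Edge A u v → ¬ T (split u v) → ¬ T (split v u) →
              NewEdge (moved u) (moved v)
      near  : ∀ {u} → T (receives u) → NewEdge (moved u) (created u)
      far   : ∀ {u v} → Edge A u v → T (split u v) → NewEdge (created u) (moved v)

    -- Nodes move uniformly from w to moved w.  Time i / j of the step, where
    -- 0 ≤ i / j ≤ 1, is treated by scaling the plane by j; as the motions are
    -- parallel and integral at both ends, any meeting time is rational.
    -- Created nodes need only be checked at the end: since the nodes of A on
    -- a line keep their order, distinct end positions leave no room for a
    -- created node to be passed.
    record NoCollision : Set where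
      field
        during : ∀ {v w} → v ∈ nodes A → w ∈ nodes A →
                 ∀ i j → i ≤ j → 0 < j →
                 j · v ⊕ i · δ v ≡ j · w ⊕ i · δ w → v ≡ w
        end-old-old : ∀ {v w} → v ∈ nodes A → w ∈ nodes A →
                      moved v ≡ moved w → v ≡ w
        end-old-new : ∀ {w u} → w ∈ nodes A → T (receives u) →
                      moved w ≢ created u
        end-new-new : ∀ {u v} → T (receives u) → T (receives v) →
                      created u ≡ created v → u ≡ v

-- B results from A by a collision-free set of growth operations, no edge
-- being deleted, with u₀ as the anchor.
record GrowthStep (u₀ : Point) (A B : Shape) : Set where
  field
    direction : Direction
    receives  : Point → Bool
    on-nodes  : ∀ {u} → T (receives u) → u ∈ nodes A
    tree      : SpanningTree A u₀

  open Operations A direction receives public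
  open SpanningTree tree using (Child)

  field
    δ                : Point → Point
    δ-path           : ∀ {w} (p : Star Child u₀ w) → δ w ≡ displacement p
    cycle-consistent : CycleConsistent

  open Result δ public

  field
    no-collision : NoCollision
    nodes-after  : ∀ p → p ∈ nodes B ⇔ NewNode p
    edges-after  : ∀ p q → Edge B p q ⇔ SymClosure NewEdge p q

-- The shape after a time step is the one at the beginning of the next, i.e.
-- the adjacency closure has been taken.
data Process (u₀ : Point) (S₀ : Shape) : ℕ → Shape → Set (suc 0ℓ) where
  start : Process u₀ S₀ zero S₀
  step  : ∀ {t A B} → Process u₀ S₀ t A → GrowthStep u₀ A B →
          Process u₀ S₀ (ℕ.suc t) (AC B)

GrowsIn : Shape → ℕ → Shape → Set (suc 0ℓ)
GrowsIn S₀ t S = ∃ λ u₀ → ∃ λ S′ →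
  u₀ ∈ nodes S₀ × Process u₀ S₀ t S′ × S′ ≅ S

{-# OPTIONS --safe #-}
module Submission where

-- The tree is built by turn depth, and within a depth by the direction d in
-- which its nodes are entered and by the parity of their column, so that the
-- lines R being added to the current region X are never side by side.  Every
-- cell of R beside a cell of X is created from it sideways, without any
-- motion.  The rest of R consists of vertical runs (d being up) that touch
-- nothing on their left or right, so a run can be stretched inside its own
-- column while everything else stands still: the node at position i moves to
-- 2i and creates a node at 2i + 1, as far as the run extends, and O(log n)
-- such steps complete all runs simultaneously.  The displacements of a step
-- form a potential on the nodes, which makes all cycles consistent although
-- every adjacency is an edge.

open import Defs
open import Level using (0ℓ)
open import Data.Bool using (Bool; true; false; T; not; if_then_else_)
open import Data.Bool.Properties as Boolₚ using ()
open import Data.Empty using (⊥-elim)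
open import Data.Fin as Fin using (Fin)
open import Data.Fin.Properties as Finₚ using ()
open import Data.Integer as ℤ using (ℤ; +_; -[1+_]; ∣_∣)
open import Data.Integer.Properties as ℤₚ using ()
import Algebra.Properties.AbelianGroup ℤₚ.+-0-abelianGroup as ℤ-group
open import Data.Integer.Solver using (module +-*-Solver)
open import Data.List using (List; []; _∷_; _∷ʳ_; length; filter; lookup)
open import Data.List.Membership.Propositional using (_∈_; find; lose)
open import Data.List.Membership.Propositional.Properties using (∈-filter⁺; ∈-filter⁻)
open import Data.List.Relation.Unary.Any as Any using (here; there)
open import Data.List.Relation.Unary.Any.Properties using (lookup-index)
open import Data.List.Relation.Unary.Unique.Propositional using (Unique)
open import Data.List.Relation.Unary.Unique.Propositional.Properties using (filter⁺)
open import Data.Nat using (ℕ; zero; suc; _+_; _*_; _∸_; _^_; _≤_; _<_; _⊔_; z≤n; s≤s; _≤?_; ⌈_/2⌉; ⌊_/2⌋)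
open import Data.Nat.Induction using (<-rec)
open import Data.Nat.Logarithm using (⌈log₂_⌉; ⌈log₂⌈n/2⌉⌉≡⌈log₂n⌉∸1; ⌈log₂⌉-mono-≤)
open import Data.Nat.Properties
open import Data.Product using (Σ; ∃; _×_; _,_; proj₁; proj₂)
open import Data.Sum using (_⊎_; inj₁; inj₂; [_,_]′)
open import Function using (_∘_; id)
open import Function.Bundles using (_⇔_; mk⇔; Equivalence)
open import Relation.Binary.Core using (Rel)
open import Relation.Binary.Construct.Closure.ReflexiveTransitive as Star using (Star; ε; _◅_; _◅◅_)
open import Relation.Binary.Construct.Closure.Symmetric as Sym using (SymClosure; fwd; bwd)
open import Relation.Binary.PropositionalEquality using (_≡_; _≢_; refl; sym; trans; cong; cong₂; subst; subst₂; module ≡-Reasoning)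
open import Relation.Nullary using (¬_; Dec; yes; no; does; contradiction)
open import Relation.Nullary.Decidable using (_×-dec_; _⊎-dec_; ¬?; map′)
open import Relation.Unary using (Pred; Decidable)

-- Where two columns stand side by side the closure creates unit squares, and consistency around a
-- square forces its two edges parallel to `d` to be split together. A run beside a stationary
-- column therefore cannot be stretched; this is why cells beside the present region are attached
-- first, and why each turn depth is split by column parity. Every intermediate shape occupies a
-- subset of the cells of `S` in their final places: an unfinished run fills the first cells of the
-- run it will become. So the root never moves, no run leaves its own cells, and node lists are
-- obtained by filtering `nodes S`. As each shape is closed under adjacency, it is determined by its
-- cells, and growth can be stated for predicates on points. The cost per turn depth is eight
-- classes (four directions, two parities), each taking three sideways or initial attachments and
-- `K + 1` doublings, where `size S ≤ 2 ^ K`.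

-- Arithmetic of points and their multiples.

⊕-assoc : ∀ p q r → (p ⊕ q) ⊕ r ≡ p ⊕ (q ⊕ r)
⊕-assoc (a , b) (c , d) (e , f) = cong₂ _,_ (ℤₚ.+-assoc a c e) (ℤₚ.+-assoc b d f)

⊕-comm : ∀ p q → p ⊕ q ≡ q ⊕ p
⊕-comm (a , b) (c , d) = cong₂ _,_ (ℤₚ.+-comm a c) (ℤₚ.+-comm b d)

⊕-identityʳ : ∀ p → p ⊕ 𝟎 ≡ p
⊕-identityʳ (a , b) = cong₂ _,_ (ℤₚ.+-identityʳ a) (ℤₚ.+-identityʳ b)

⊕-cancelˡ : ∀ p {q r} → p ⊕ q ≡ p ⊕ r → q ≡ r
⊕-cancelˡ (a , b) eq =
  cong₂ _,_ (ℤ-group.∙-cancelˡ a _ _ (cong proj₁ eq)) (ℤ-group.∙-cancelˡ b _ _ (cong proj₂ eq))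

⊕-cancelʳ : ∀ p {q r} → q ⊕ p ≡ r ⊕ p → q ≡ r
⊕-cancelʳ p {q} {r} eq = ⊕-cancelˡ p (trans (⊕-comm p q) (trans eq (⊕-comm r p)))

⊕-swapʳ : ∀ p q r → (p ⊕ q) ⊕ r ≡ (p ⊕ r) ⊕ q
⊕-swapʳ p q r = trans (⊕-assoc p q r) (trans (cong (p ⊕_) (⊕-comm q r)) (sym (⊕-assoc p r q)))

[p⊕q]⊖p≡q : ∀ p q → (p ⊕ q) ⊖ p ≡ q
[p⊕q]⊖p≡q (a , b) (c , d) = cong₂ _,_ (lemma a c) (lemma b d)
  where
  open +-*-Solver
  lemma : ∀ x y → (x ℤ.+ y) ℤ.- x ≡ y
  lemma = solve 2 (λ x y → (x :+ y) :- x := y) refl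

p⊕[q⊖p]≡q : ∀ p q → p ⊕ (q ⊖ p) ≡ q
p⊕[q⊖p]≡q (a , b) (c , d) = cong₂ _,_ (lemma a c) (lemma b d)
  where
  open +-*-Solver
  lemma : ∀ x y → x ℤ.+ (y ℤ.- x) ≡ y
  lemma = solve 2 (λ x y → x :+ (y :- x) := y) refl

p⊖p≡𝟎 : ∀ p → p ⊖ p ≡ 𝟎
p⊖p≡𝟎 (a , b) = cong₂ _,_ (ℤₚ.+-inverseʳ a) (ℤₚ.+-inverseʳ b)

p⊖𝟎≡p : ∀ p → p ⊖ 𝟎 ≡ p
p⊖𝟎≡p = ⊕-identityʳ

⊖-telescope : ∀ p q r → (q ⊖ p) ⊕ (r ⊖ q) ≡ r ⊖ p
⊖-telescope p q r = ⊕-cancelˡ p (begin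
  p ⊕ ((q ⊖ p) ⊕ (r ⊖ q))  ≡⟨ ⊕-assoc p _ _ ⟨
  (p ⊕ (q ⊖ p)) ⊕ (r ⊖ q)  ≡⟨ cong (_⊕ (r ⊖ q)) (p⊕[q⊖p]≡q p q) ⟩
  q ⊕ (r ⊖ q)              ≡⟨ p⊕[q⊖p]≡q q r ⟩
  r                        ≡⟨ p⊕[q⊖p]≡q p r ⟨
  p ⊕ (r ⊖ p)              ∎)
  where open ≡-Reasoning

⊖-antisym : ∀ p q → p ⊖ q ≡ 𝟎 ⊖ (q ⊖ p)
⊖-antisym (a , b) (c , d) = cong₂ _,_ (lemma a c) (lemma b d)
  where
  open +-*-Solver
  lemma : ∀ x y → x ℤ.- y ≡ + 0 ℤ.- (y ℤ.- x)
  lemma = solve 2 (λ x y → x :- y := con (+ 0) :- (y :- x)) refl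

0·-zero : ∀ p → 0 · p ≡ 𝟎
0·-zero (a , b) = cong₂ _,_ (ℤₚ.*-zeroˡ a) (ℤₚ.*-zeroˡ b)

1·-identity : ∀ p → 1 · p ≡ p
1·-identity (a , b) = cong₂ _,_ (ℤₚ.*-identityˡ a) (ℤₚ.*-identityˡ b)

·-distribʳ-+ : ∀ m n p → (m + n) · p ≡ m · p ⊕ n · p
·-distribʳ-+ m n (a , b) =
  cong₂ _,_ (ℤₚ.*-distribʳ-+ a (+ m) (+ n)) (ℤₚ.*-distribʳ-+ b (+ m) (+ n))

·-distribˡ-⊕ : ∀ m p q → m · (p ⊕ q) ≡ m · p ⊕ m · q
·-distribˡ-⊕ m (a , b) (c , d) =
  cong₂ _,_ (ℤₚ.*-distribˡ-+ (+ m) a c) (ℤₚ.*-distribˡ-+ (+ m) b d)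

·-·-assoc : ∀ m n p → (m * n) · p ≡ m · (n · p)
·-·-assoc m n (a , b) = cong₂ _,_ (lemma a) (lemma b)
  where
  lemma : ∀ x → + (m * n) ℤ.* x ≡ + m ℤ.* (+ n ℤ.* x)
  lemma x = trans (cong (ℤ._* x) (ℤₚ.pos-* m n)) (ℤₚ.*-assoc (+ m) (+ n) x)

⊕-0· : ∀ p q → p ⊕ 0 · q ≡ p
⊕-0· p q = trans (cong (p ⊕_) (0·-zero q)) (⊕-identityʳ p)

⊕-1· : ∀ p q → p ⊕ 1 · q ≡ p ⊕ q
⊕-1· p q = cong (p ⊕_) (1·-identity q)

⊕-+· : ∀ p m n q → p ⊕ (m + n) · q ≡ (p ⊕ m · q) ⊕ n · q
⊕-+· p m n q = trans (cong (p ⊕_) (·-distribʳ-+ m n q)) (sym (⊕-assoc p _ _))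

⊕-suc· : ∀ p n q → p ⊕ suc n · q ≡ (p ⊕ n · q) ⊕ q
⊕-suc· p n q = trans (cong (λ m → p ⊕ m · q) (+-comm 1 n))
  (trans (⊕-+· p n 1 q) (⊕-1· (p ⊕ n · q) q))

-- Directions and grid adjacency.

opposite : Direction → Direction
opposite north = south
opposite east  = west
opposite south = north
opposite west  = east

clockwise : Direction → Direction
clockwise north = east
clockwise east  = south
clockwise south = west
clockwise west  = north

directions : ∀ d d′ →
  d′ ≡ d ⊎ d′ ≡ opposite d ⊎ d′ ≡ clockwise d ⊎ d′ ≡ opposite (clockwise d)
directions north north = inj₁ refl
directions north east  = inj₂ (inj₂ (inj₁ refl))
directions north south = inj₂ (inj₁ refl)
directions north west  = inj₂ (inj₂ (inj₂ refl))
directions east  north = inj₂ (inj₂ (inj₂ refl))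
directions east  east  = inj₁ refl
directions east  south = inj₂ (inj₂ (inj₁ refl))
directions east  west  = inj₂ (inj₁ refl)
directions south north = inj₂ (inj₁ refl)
directions south east  = inj₂ (inj₂ (inj₂ refl))
directions south south = inj₁ refl
directions south west  = inj₂ (inj₂ (inj₁ refl))
directions west  north = inj₂ (inj₂ (inj₁ refl))
directions west  east  = inj₂ (inj₁ refl)
directions west  south = inj₂ (inj₂ (inj₂ refl))
directions west  west  = inj₁ refl

unit-opposite : ∀ d → unit d ⊕ unit (opposite d) ≡ 𝟎
unit-opposite north = refl
unit-opposite east  = refl
unit-opposite south = refl
unit-opposite west  = refl

forth-back : ∀ d p → (p ⊕ unit d) ⊕ unit (opposite d) ≡ p
forth-back d p = trans (⊕-assoc p _ _) (trans (cong (p ⊕_) (unit-opposite d)) (⊕-identityʳ p))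

back-forth : ∀ d p → (p ⊕ unit (opposite d)) ⊕ unit d ≡ p
back-forth d p = trans (⊕-swapʳ p _ _) (forth-back d p)

unit-adjacent : ∀ p d → Adjacent p (p ⊕ unit d)
unit-adjacent p@(x , y) d = trans (cong norm (⊖-antisym p (p ⊕ unit d)))
  (trans (cong (λ v → norm (𝟎 ⊖ v)) ([p⊕q]⊖p≡q p (unit d))) (norm-unit d))
  where
  norm : Point → ℕ
  norm (a , b) = ∣ a ∣ + ∣ b ∣
  norm-unit : ∀ d → norm (𝟎 ⊖ unit d) ≡ 1
  norm-unit north = refl
  norm-unit east  = refl
  norm-unit south = refl
  norm-unit west  = refl

norm≡1 : ∀ a b → ∣ a ∣ + ∣ b ∣ ≡ 1 → ∃ λ d → 𝟎 ⊖ (a , b) ≡ unit d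
norm≡1 (+ 0)    (+ 1)    _ = south , refl
norm≡1 (+ 0)    -[1+ 0 ] _ = north , refl
norm≡1 (+ 1)    (+ 0)    _ = west , refl
norm≡1 -[1+ 0 ] (+ 0)    _ = east , refl
norm≡1 (+ 0) (+ 0) ()
norm≡1 (+ suc (suc _)) _ ()
norm≡1 (+ 1) (+ suc _) ()
norm≡1 (+ 1) -[1+ _ ] ()
norm≡1 -[1+ suc _ ] _ ()
norm≡1 -[1+ 0 ] (+ suc _) ()
norm≡1 -[1+ 0 ] -[1+ _ ] ()

adjacent-unit : ∀ p q → Adjacent p q → ∃ λ d → q ≡ p ⊕ unit d
adjacent-unit p@(x , y) q@(x′ , y′) adj
  with d , eq ← norm≡1 (x ℤ.- x′) (y ℤ.- y′) adj
  = d , trans (sym (p⊕[q⊖p]≡q p q)) (cong (p ⊕_) (trans (⊖-antisym q p) eq))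

-- `behind` and `left` are equations for `p`, so that matching on `refl` turns them into `ahead` and
-- `right` with the endpoints exchanged; only two cases then need a computation.
data Oriented (d : Direction) (p q : Point) : Set where
  ahead  : q ≡ p ⊕ unit d → Oriented d p q
  behind : p ≡ q ⊕ unit d → Oriented d p q
  right  : q ≡ p ⊕ unit (clockwise d) → Oriented d p q
  left   : p ≡ q ⊕ unit (clockwise d) → Oriented d p q

orient : ∀ d p q → Adjacent p q → Oriented d p q
orient d p q adj with adjacent-unit p q adj
... | d′ , eq with directions d d′
...   | inj₁ refl               = ahead eq
...   | inj₂ (inj₁ refl)        = behind (sym (trans (cong (_⊕ unit d) eq) (back-forth d p)))
...   | inj₂ (inj₂ (inj₁ refl)) = right eq
...   | inj₂ (inj₂ (inj₂ refl)) =
  left (sym (trans (cong (_⊕ unit (clockwise d)) eq) (back-forth (clockwise d) p)))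

p⊕unit≢p : ∀ p d → p ⊕ unit d ≢ p
p⊕unit≢p p d eq with ⊕-cancelˡ p (trans eq (sym (⊕-identityʳ p)))
p⊕unit≢p p north eq | ()
p⊕unit≢p p east  eq | ()
p⊕unit≢p p south eq | ()
p⊕unit≢p p west  eq | ()

p⊕2unit≢p : ∀ p d → (p ⊕ unit d) ⊕ unit d ≢ p
p⊕2unit≢p p d eq
  with d | ⊕-cancelˡ p (trans (sym (⊕-assoc p (unit d) (unit d))) (trans eq (sym (⊕-identityʳ p))))
... | north | ()
... | east  | ()
... | south | ()
... | west  | ()

clockwise-ahead : ∀ p d → p ⊕ unit d ≢ p ⊕ unit (clockwise d)
clockwise-ahead p d eq with d | ⊕-cancelˡ p eq
... | north | ()
... | east  | ()
... | south | ()
... | west  | ()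

clockwise-behind : ∀ p d → (p ⊕ unit (clockwise d)) ⊕ unit d ≢ p
clockwise-behind p d eq
  with d | ⊕-cancelˡ p (trans (sym (⊕-assoc p (unit (clockwise d)) (unit d))) (trans eq (sym (⊕-identityʳ p))))
... | north | ()
... | east  | ()
... | south | ()
... | west  | ()

-- Meetings of parallel motions in the scaled plane.

private
  quotient : ∀ j k z → + suc j ℤ.* z ≡ + k → ∃ λ c → k ≡ suc j * c × z ≡ + c
  quotient j k (+ c) h = c , ℤₚ.+-injective (trans (sym h) (sym (ℤₚ.pos-* (suc j) c))) , refl

  *-distribˡ-- : ∀ a x y → a ℤ.* (y ℤ.- x) ≡ a ℤ.* y ℤ.- a ℤ.* x
  *-distribˡ-- = solve 3 (λ a x y → a :* (y :- x) := a :* y :- a :* x) refl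
    where open +-*-Solver

  [a+b]-a≡b : ∀ a b → a ℤ.+ b ℤ.- a ≡ b
  [a+b]-a≡b = solve 2 (λ a b → a :+ b :- a := b) refl
    where open +-*-Solver

  a+[b-a]≡b : ∀ a b → a ℤ.+ (b ℤ.- a) ≡ b
  a+[b-a]≡b = solve 2 (λ a b → a :+ (b :- a) := b) refl
    where open +-*-Solver

  a-b+b≡a : ∀ a b → a ℤ.+ ℤ.- b ℤ.+ b ≡ a
  a-b+b≡a = solve 2 (λ a b → a :+ (:- b) :+ b := a) refl
    where open +-*-Solver

  a+b-b≡a : ∀ a b → a ℤ.+ b ℤ.+ ℤ.- b ≡ a
  a+b-b≡a = solve 2 (λ a b → a :+ b :+ (:- b) := a) refl
    where open +-*-Solver

  *-minus-one : ∀ a → a ℤ.* -[1+ 0 ] ≡ ℤ.- a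
  *-minus-one a = trans (ℤₚ.*-comm a -[1+ 0 ]) (ℤₚ.-1*i≡-i a)

  module _ (j k : ℕ) where

    -- The coordinate across the direction of motion. The void summand with an arbitrary `c` is kept
    -- so that both coordinates together are literally those of `v ⊕ c · unit d`.
    unmoved : ∀ x y → + suc j ℤ.* x ℤ.+ + k ℤ.* + 0 ≡ + suc j ℤ.* y → ∀ c → y ≡ x ℤ.+ + c ℤ.* + 0
    unmoved x y h c =
      trans (sym (ℤₚ.*-cancelˡ-≡ (+ suc j) x y (trans (sym (drop (+ suc j ℤ.* x) k)) h))) (sym (drop x c))
      where
      drop : ∀ z n → z ℤ.+ + n ℤ.* + 0 ≡ z
      drop z n = trans (cong (λ i → z ℤ.+ i) (ℤₚ.*-zeroʳ (+ n))) (ℤₚ.+-identityʳ z)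

    forward : ∀ x y → + suc j ℤ.* x ℤ.+ + k ≡ + suc j ℤ.* y →
      ∃ λ c → k ≡ suc j * c × y ≡ x ℤ.+ + c
    forward x y h = finish (quotient j k (y ℤ.- x) (trans (*-distribˡ-- (+ suc j) x y)
        (trans (cong (λ z → z ℤ.- + suc j ℤ.* x) (sym h)) ([a+b]-a≡b (+ suc j ℤ.* x) (+ k)))))
      where
      finish : (∃ λ c → k ≡ suc j * c × y ℤ.- x ≡ + c) → ∃ λ c → k ≡ suc j * c × y ≡ x ℤ.+ + c
      finish (c , k≡ , y-x≡) = c , k≡ , trans (sym (a+[b-a]≡b x y)) (cong (λ z → x ℤ.+ z) y-x≡)

    forward₁ : ∀ x y → + suc j ℤ.* x ℤ.+ + k ℤ.* + 1 ≡ + suc j ℤ.* y →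
      ∃ λ c → k ≡ suc j * c × y ≡ x ℤ.+ + c ℤ.* + 1
    forward₁ x y h = finish (forward x y
        (trans (cong (λ z → + suc j ℤ.* x ℤ.+ z) (sym (ℤₚ.*-identityʳ (+ k)))) h))
      where
      finish : (∃ λ c → k ≡ suc j * c × y ≡ x ℤ.+ + c) → ∃ λ c → k ≡ suc j * c × y ≡ x ℤ.+ + c ℤ.* + 1
      finish (c , k≡ , y≡) = c , k≡ , trans y≡ (cong (λ z → x ℤ.+ z) (sym (ℤₚ.*-identityʳ (+ c))))

    backward₁ : ∀ x y → + suc j ℤ.* x ℤ.+ + k ℤ.* -[1+ 0 ] ≡ + suc j ℤ.* y →
      ∃ λ c → k ≡ suc j * c × y ≡ x ℤ.+ + c ℤ.* -[1+ 0 ]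
    backward₁ x y h = finish (forward y x (trans (cong (λ z → z ℤ.+ + k) (sym h))
        (trans (cong (λ z → + suc j ℤ.* x ℤ.+ z ℤ.+ + k) (*-minus-one (+ k))) (a-b+b≡a (+ suc j ℤ.* x) (+ k)))))
      where
      finish : (∃ λ c → k ≡ suc j * c × x ≡ y ℤ.+ + c) →
        ∃ λ c → k ≡ suc j * c × y ≡ x ℤ.+ + c ℤ.* -[1+ 0 ]
      finish (c , k≡ , x≡) = c , k≡ , trans (sym (a+b-b≡a y (+ c)))
        (cong₂ ℤ._+_ (sym x≡) (sym (*-minus-one (+ c))))

-- Along `d` the equation says that `j` times the difference of `w` and `v` is `k`; hence `j`
-- divides `k`, and `k` being a natural number fixes the sign. Across `d` the difference vanishes.
scaled-line : ∀ d j k v w → 0 < j → j · v ⊕ k · unit d ≡ j · w →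
  ∃ λ c → k ≡ j * c × w ≡ v ⊕ c · unit d
scaled-line north (suc j) k (x , y) (x′ , y′) _ eq =
  let c , k≡ , y≡ = forward₁ j k y y′ (cong proj₂ eq)
  in c , k≡ , cong₂ _,_ (unmoved j k x x′ (cong proj₁ eq) c) y≡
scaled-line east (suc j) k (x , y) (x′ , y′) _ eq =
  let c , k≡ , x≡ = forward₁ j k x x′ (cong proj₁ eq)
  in c , k≡ , cong₂ _,_ x≡ (unmoved j k y y′ (cong proj₂ eq) c)
scaled-line south (suc j) k (x , y) (x′ , y′) _ eq =
  let c , k≡ , y≡ = backward₁ j k y y′ (cong proj₂ eq)
  in c , k≡ , cong₂ _,_ (unmoved j k x x′ (cong proj₁ eq) c) y≡
scaled-line west (suc j) k (x , y) (x′ , y′) _ eq =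
  let c , k≡ , x≡ = backward₁ j k x x′ (cong proj₁ eq)
  in c , k≡ , cong₂ _,_ x≡ (unmoved j k y y′ (cong proj₂ eq) c)

-- v pushed by m and w pushed by n units along d meet in the plane scaled by j.
data Aligned (d : Direction) (j m n : ℕ) (v w : Point) : Set where
  before : ∀ c → w ≡ v ⊕ c · unit d → m ≡ j * c + n → Aligned d j m n v w
  after  : ∀ c → v ≡ w ⊕ c · unit d → n ≡ j * c + m → Aligned d j m n v w

-- The smaller of the two pushes is cancelled on both sides, which leaves only one point moving.
align : ∀ d j {m n v w} → 0 < j → j · v ⊕ m · unit d ≡ j · w ⊕ n · unit d → Aligned d j m n v w
align d j {m} {n} {v} {w} 0<j eq =
  [ (λ n≤m → let c , k≡ , w≡ = push v w n≤m eq
             in before c w≡ (trans (sym (m∸n+n≡m n≤m)) (cong (_+ n) k≡)))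
  , (λ m≤n → let c , k≡ , v≡ = push w v m≤n (sym eq)
             in after c v≡ (trans (sym (m∸n+n≡m m≤n)) (cong (_+ m) k≡)))
  ]′ (≤-total n m)
  where
  push : ∀ {m n} v w → n ≤ m → j · v ⊕ m · unit d ≡ j · w ⊕ n · unit d →
    ∃ λ c → m ∸ n ≡ j * c × w ≡ v ⊕ c · unit d
  push {m} {n} v w n≤m eq = scaled-line d j (m ∸ n) v w 0<j (⊕-cancelʳ (n · unit d)
    (trans (sym (⊕-+· (j · v) (m ∸ n) n (unit d)))
      (trans (cong (λ k → j · v ⊕ k · unit d) (m∸n+n≡m n≤m)) eq)))

-- Breadth-first spanning trees.

infix 4 _∈ₚ?_

_∈ₚ?_ : ∀ p (ps : List Point) → Dec (p ∈ ps)
p ∈ₚ? ps = Any.any? (p ≟ₚ_) ps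

any-direction? : ∀ {P : Direction → Set} → (∀ d → Dec (P d)) → Dec (∃ P)
any-direction? {P} P? = map′
  [ (north ,_) , [ (east ,_) , [ (south ,_) , (west ,_) ]′ ]′ ]′ cases
  (P? north ⊎-dec P? east ⊎-dec P? south ⊎-dec P? west)
  where
  cases : ∃ P → P north ⊎ P east ⊎ P south ⊎ P west
  cases (north , x) = inj₁ x
  cases (east  , x) = inj₂ (inj₁ x)
  cases (south , x) = inj₂ (inj₂ (inj₁ x))
  cases (west  , x) = inj₂ (inj₂ (inj₂ x))

Induced : Shape → Set
Induced A = ∀ {p q} → p ∈ nodes A → q ∈ nodes A → Adjacent p q → Edge A p q

-- A breadth-first search tree: the parent of a node is a neighbour nearer to
-- the root.
module BreadthFirst (A : Shape) (induced : Induced A) (root : Point) (root∈ : root ∈ nodes A) where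

  Near : ℕ → Point → Set
  Near zero    w = w ≡ root
  Near (suc n) w = Near n w ⊎ ∃ λ d → (w ⊕ unit d) ∈ nodes A × Near n (w ⊕ unit d)

  near? : ∀ n w → Dec (Near n w)
  near? zero    w = w ≟ₚ root
  near? (suc n) w = near? n w ⊎-dec
    any-direction? (λ d → ((w ⊕ unit d) ∈ₚ? nodes A) ×-dec near? n (w ⊕ unit d))

  near-mono : ∀ {m n w} → m ≤ n → Near m w → Near n w
  near-mono {m} {n} {w} m≤n x = subst (λ k → Near k w) (m∸n+n≡m m≤n) (raise (n ∸ m))
    where
    raise : ∀ k → Near (k + m) w
    raise zero    = x
    raise (suc k) = inj₁ (raise k)

  walk-near : ∀ {w} → Star (Edge A) w root → ∃ λ n → Near n w
  walk-near ε = 0 , refl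
  walk-near {w} (_◅_ {j = v} e p) with adjacent-unit w v (edge-adj A e) | walk-near p
  ... | d , refl | n , x = suc n , inj₂ (d , edge-node A (edge-sym A e) , x)

  Nearest : Point → Set
  Nearest w = ∃ λ r → Near r w × (∀ m → Near m w → r ≤ m)

  nearest : ∀ n w → Near n w → Nearest w
  nearest zero    w x = 0 , x , λ _ _ → z≤n
  nearest (suc n) w x with near? n w
  ... | yes y = nearest n w y
  ... | no ¬y = suc n , x , λ m z → ≰⇒> (λ m≤n → ¬y (near-mono m≤n z))

  towards : ∀ w → Nearest w → Point
  towards w (suc r , inj₂ (d , _) , _) = w ⊕ unit d
  towards w _                          = w

  -- Minimality of the level excludes the case in which `w` was already reached one level earlier.
  -- The last component speaks of every `n`, so that `path` can descend from any bound on the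
  -- distance and not only from the least one.
  towards-closer : ∀ w (x : Nearest w) → w ≢ root →
    towards w x ∈ nodes A × Adjacent w (towards w x) × (∀ n → Near (suc n) w → Near n (towards w x))
  towards-closer w (zero , w≡root , _) w≢root = contradiction w≡root w≢root
  towards-closer w (suc r , inj₁ y , least) _ = contradiction (least r y) 1+n≰n
  towards-closer w (suc r , inj₂ (d , v∈ , x) , least) _ =
    v∈ , unit-adjacent w d , λ n y → near-mono (≤-pred (least (suc n) y)) x

  near : ∀ {w} → w ∈ nodes A → ∃ λ n → Near n w
  near w∈ = walk-near (connected A w∈ root∈)

  parent : Point → Point
  parent w with w ∈ₚ? nodes A
  ... | yes w∈ = towards w (nearest (proj₁ (near w∈)) w (proj₂ (near w∈)))
  ... | no _   = w

  parent-closer : ∀ {w} → w ∈ nodes A → w ≢ root →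
    parent w ∈ nodes A × Adjacent w (parent w) × (∀ n → Near (suc n) w → Near n (parent w))
  parent-closer {w} w∈ w≢root with w ∈ₚ? nodes A
  ... | yes w∈ = towards-closer w _ w≢root
  ... | no w∉  = contradiction w∈ w∉

  Child : Rel Point 0ℓ
  Child x w = w ∈ nodes A × w ≢ root × parent w ≡ x

  path : ∀ n {w} → Near n w → w ∈ nodes A → Star Child root w
  path zero    refl _ = ε
  path (suc n) {w} x w∈ with w ≟ₚ root
  ... | yes refl = ε
  ... | no w≢root with v∈ , _ , closer ← parent-closer w∈ w≢root
    = path n (closer n x) v∈ ◅◅ ((w∈ , w≢root , refl) ◅ ε)

  spanningTree : SpanningTree A root
  spanningTree = record
    { parent     = parent
    ; root-node  = root∈
    ; child-edge = λ { {x} {w} (w∈ , w≢root , refl) →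
        let v∈ , adj , _ = parent-closer w∈ w≢root
        in induced v∈ w∈ (Adjacent-sym {w} {parent w} adj) }
    ; path       = λ w∈ → path (proj₁ (near w∈)) (proj₂ (near w∈)) w∈
    }

-- Growth steps whose displacement is a potential.

bit : Bool → ℕ
bit b = if b then 1 else 0

-- A set of operations in direction d, with the displacement of each node w
-- given as shift w units in direction d.  The displacement being a potential,
-- cycle consistency is automatic; order says that nodes on a line neither
-- pass each other nor run into a created node.
record Push (In : Pred Point 0ℓ) (root : Point) (d : Direction) : Set where
  field
    receives   : Point → Bool
    on-nodes   : ∀ {u} → T (receives u) → In u
    shift      : Point → ℕ
    shift-root : shift root ≡ 0
    along      : ∀ {u} → In u → In (u ⊕ unit d) →
                 shift (u ⊕ unit d) ≡ shift u + bit (receives u)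
    across     : ∀ {u} → In u → In (u ⊕ unit (clockwise d)) →
                 shift (u ⊕ unit (clockwise d)) ≡ shift u
    order      : ∀ {u} a → In u → In (u ⊕ suc a · unit d) →
                 shift u + bit (receives u) < suc a + shift (u ⊕ suc a · unit d)

module PushStep {A : Shape} (induced : Induced A) {root : Point} (root∈ : root ∈ nodes A)
  {d : Direction} (push : Push (_∈ nodes A) root d) where

  open Push push
  open Operations A d receives

  δ : Point → Point
  δ w = shift w · unit d

  open Result δ

  created≡ : ∀ u → created u ≡ u ⊕ suc (shift u) · unit d
  created≡ u = sym (⊕-suc· u (shift u) (unit d))

  ¬T⇒≡false : ∀ {b} → ¬ T b → b ≡ false
  ¬T⇒≡false {false} _ = refl
  ¬T⇒≡false {true}  h = contradiction _ h

  split⇒ : ∀ {u v} → T (split u v) → T (receives u) × u ⊕ unit d ≡ v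
  split⇒ {u} {v} s with receives u | (u ⊕ unit d) ≟ₚ v
  ... | true | yes eq = _ , eq

  split-ahead : ∀ u → split u (u ⊕ unit d) ≡ receives u
  split-ahead u with receives u | (u ⊕ unit d) ≟ₚ (u ⊕ unit d)
  ... | false | _     = refl
  ... | true  | yes _ = refl
  ... | true  | no ne = contradiction refl ne

  ¬split : ∀ {u v} → u ⊕ unit d ≢ v → split u v ≡ false
  ¬split ne = ¬T⇒≡false (λ s → ne (proj₂ (split⇒ s)))

  choose : Bool → Point
  choose b = if b then unit d else 𝟎

  choose≡ : ∀ b → choose b ≡ bit b · unit d
  choose≡ false = sym (0·-zero (unit d))
  choose≡ true  = sym (1·-identity (unit d))

  -- The upper endpoint cannot split this edge, as its operation points away from `u`; what remains
  -- is the bit of `u`, which `along` equates with the difference of shifts.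
  contribution-ahead : ∀ {u} → u ∈ nodes A → (u ⊕ unit d) ∈ nodes A →
    contribution u (u ⊕ unit d) ≡ δ (u ⊕ unit d) ⊖ δ u
  contribution-ahead {u} u∈ v∈ = begin
    choose (split u (u ⊕ unit d)) ⊖ choose (split (u ⊕ unit d) u)
      ≡⟨ cong₂ (λ a b → choose a ⊖ choose b) (split-ahead u) (¬split (p⊕2unit≢p u d)) ⟩
    choose (receives u) ⊖ 𝟎
      ≡⟨ p⊖𝟎≡p (choose (receives u)) ⟩
    choose (receives u)
      ≡⟨ choose≡ (receives u) ⟩
    bit (receives u) · unit d
      ≡⟨ [p⊕q]⊖p≡q (δ u) (bit (receives u) · unit d) ⟨
    (δ u ⊕ bit (receives u) · unit d) ⊖ δ u
      ≡⟨ cong (_⊖ δ u) (·-distribʳ-+ (shift u) (bit (receives u)) (unit d)) ⟨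
    (shift u + bit (receives u)) · unit d ⊖ δ u
      ≡⟨ cong (λ n → n · unit d ⊖ δ u) (along u∈ v∈) ⟨
    δ (u ⊕ unit d) ⊖ δ u ∎
    where open ≡-Reasoning

  contribution-right : ∀ {u} → u ∈ nodes A → (u ⊕ unit (clockwise d)) ∈ nodes A →
    contribution u (u ⊕ unit (clockwise d)) ≡ δ (u ⊕ unit (clockwise d)) ⊖ δ u
  contribution-right {u} u∈ v∈ = begin
    choose (split u v) ⊖ choose (split v u)
      ≡⟨ cong₂ (λ a b → choose a ⊖ choose b)
           (¬split (clockwise-ahead u d)) (¬split (clockwise-behind u d)) ⟩
    𝟎
      ≡⟨ p⊖p≡𝟎 (δ u) ⟨
    δ u ⊖ δ u
      ≡⟨ cong (λ n → n · unit d ⊖ δ u) (across u∈ v∈) ⟨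
    δ v ⊖ δ u ∎
    where
    open ≡-Reasoning
    v = u ⊕ unit (clockwise d)

  contribution-swap : ∀ {u v} → contribution v u ≡ δ u ⊖ δ v → contribution u v ≡ δ v ⊖ δ u
  contribution-swap {u} {v} eq = begin
    contribution u v       ≡⟨ ⊖-antisym (choose (split u v)) (choose (split v u)) ⟩
    𝟎 ⊖ contribution v u   ≡⟨ cong (𝟎 ⊖_) eq ⟩
    𝟎 ⊖ (δ u ⊖ δ v)        ≡⟨ ⊖-antisym (δ v) (δ u) ⟨
    δ v ⊖ δ u              ∎
    where open ≡-Reasoning

  contribution-edge : ∀ {u v} → Edge A u v → contribution u v ≡ δ v ⊖ δ u
  contribution-edge {u} {v} e = go (orient d u v (edge-adj A e))
    where
    u∈ = edge-node A e
    v∈ = edge-node A (edge-sym A e)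
    go : Oriented d u v → contribution u v ≡ δ v ⊖ δ u
    go (ahead refl)  = contribution-ahead u∈ v∈
    go (behind refl) = contribution-swap {u} {v} (contribution-ahead v∈ u∈)
    go (right refl)  = contribution-right u∈ v∈
    go (left refl)   = contribution-swap {u} {v} (contribution-right v∈ u∈)

  -- The sum telescopes. `R` is left open because this is applied both to tree walks, for `δ-path`,
  -- and to pieces of cycles.
  displacement≡ : ∀ {R : Rel Point 0ℓ} → (∀ {u v} → R u v → Edge A u v) →
    ∀ {u v} (p : Star R u v) → displacement p ≡ δ v ⊖ δ u
  displacement≡ edge {u} ε = sym (p⊖p≡𝟎 (δ u))
  displacement≡ edge {u} {w} (_◅_ {j = v} e p) =
    trans (cong₂ _⊕_ (contribution-edge (edge e)) (displacement≡ edge p)) (⊖-telescope (δ u) (δ v) (δ w))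

  shift-kept : ∀ {u v} → Edge A u v → ¬ T (split u v) → ¬ T (split v u) → δ v ≡ δ u
  shift-kept {u} {v} e ¬s ¬s′ = begin
    δ v                          ≡⟨ p⊕[q⊖p]≡q (δ u) (δ v) ⟨
    δ u ⊕ (δ v ⊖ δ u)            ≡⟨ cong (δ u ⊕_) (contribution-edge e) ⟨
    δ u ⊕ contribution u v       ≡⟨ cong₂ (λ a b → δ u ⊕ (choose a ⊖ choose b)) (¬T⇒≡false ¬s) (¬T⇒≡false ¬s′) ⟩
    δ u ⊕ 𝟎                      ≡⟨ ⊕-identityʳ (δ u) ⟩
    δ u                          ∎
    where open ≡-Reasoning

  T⇒bit≡1 : ∀ {b} → T b → bit b ≡ 1
  T⇒bit≡1 {true} _ = refl

  moved-split : ∀ {u v} → Edge A u v → T (split u v) → moved v ≡ created u ⊕ unit d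
  moved-split {u} {v} e s with split⇒ {u} {v} s
  ... | r , refl = begin
    (u ⊕ unit d) ⊕ shift v · unit d
      ≡⟨ ⊕-swapʳ u (unit d) (shift v · unit d) ⟩
    (u ⊕ shift v · unit d) ⊕ unit d
      ≡⟨ cong (λ n → (u ⊕ n · unit d) ⊕ unit d) (trans (along (edge-node A e) (edge-node A (edge-sym A e)))
           (trans (cong (λ b → shift u + b) (T⇒bit≡1 r)) (+-comm (shift u) 1))) ⟩
    (u ⊕ suc (shift u) · unit d) ⊕ unit d
      ≡⟨ cong (_⊕ unit d) (created≡ u) ⟨
    created u ⊕ unit d ∎
    where open ≡-Reasoning

  newEdge-adjacent : ∀ {p q} → NewEdge p q → Adjacent p q
  newEdge-adjacent (kept {u} {v} e ¬s ¬s′) with adjacent-unit u v (edge-adj A e)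
  ... | d′ , refl = subst (Adjacent (moved u))
    (trans (⊕-swapʳ u (δ u) (unit d′)) (cong ((u ⊕ unit d′) ⊕_) (sym (shift-kept e ¬s ¬s′))))
    (unit-adjacent (moved u) d′)
  newEdge-adjacent (near {u} _) = unit-adjacent (moved u) d
  newEdge-adjacent (far {u} {v} e s) =
    subst (Adjacent (created u)) (sym (moved-split e s)) (unit-adjacent (created u) d)

  newEdge-nodes : ∀ {p q} → NewEdge p q → NewNode p × NewNode q
  newEdge-nodes (kept e _ _) = old (edge-node A e) , old (edge-node A (edge-sym A e))
  newEdge-nodes (near r)     = old (on-nodes r) , new r
  newEdge-nodes (far {u} {v} e s) = new (proj₁ (split⇒ {u} {v} s)) , old (edge-node A (edge-sym A e))

  Link : Rel Point 0ℓ
  Link = Star (SymClosure NewEdge)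

  link-sym : ∀ {p q} → Link p q → Link q p
  link-sym = Star.reverse (Sym.symmetric NewEdge)

  T? : ∀ b → Dec (T b)
  T? true  = yes _
  T? false = no id

  link-split : ∀ {u v} → Edge A u v → T (split u v) → Link (moved u) (moved v)
  link-split {u} {v} e s = fwd (near (proj₁ (split⇒ {u} {v} s))) ◅ fwd (far e s) ◅ ε

  link-edge : ∀ {u v} → Edge A u v → Link (moved u) (moved v)
  link-edge {u} {v} e with T? (split u v) | T? (split v u)
  ... | yes s | _      = link-split e s
  ... | no _  | yes s  = link-sym (link-split (edge-sym A e) s)
  ... | no ¬s | no ¬s′ = fwd (kept e ¬s ¬s′) ◅ ε

  link-root : ∀ {p} → NewNode p → Link p (moved root)
  link-root (old w∈) = Star.kleisliStar moved link-edge (connected A w∈ root∈)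
  link-root (new r)  = bwd (near r) ◅ Star.kleisliStar moved link-edge (connected A (on-nodes r) root∈)

  ≤-order : ∀ {u} a → u ∈ nodes A → (u ⊕ suc a · unit d) ∈ nodes A →
    shift u < suc a + shift (u ⊕ suc a · unit d)
  ≤-order {u} a u∈ w∈ = ≤-<-trans (m≤m+n (shift u) (bit (receives u))) (order a u∈ w∈)

  -- For `c = suc a`, `order` gives `shift v ≤ a + shift w`. At time `i / j` the pursuer has thus
  -- gained at most `i * a` on the other node, and `i * a ≤ j * a < j * suc a` falls short of the
  -- gap.
  not-behind : ∀ {v} i j c → i ≤ j → 0 < j → v ∈ nodes A → (v ⊕ c · unit d) ∈ nodes A →
    i * shift v ≡ j * c + i * shift (v ⊕ c · unit d) → v ≡ v ⊕ c · unit d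
  not-behind {v} i j zero _ _ _ _ _ = sym (⊕-0· v (unit d))
  not-behind {v} i j@(suc _) (suc a) i≤j 0<j v∈ w∈ eq = contradiction eq (<⇒≢ (begin-strict
    i * shift v                                        ≤⟨ *-monoʳ-≤ i (≤-pred (≤-order a v∈ w∈)) ⟩
    i * (a + shift (v ⊕ suc a · unit d))               ≡⟨ *-distribˡ-+ i a _ ⟩
    i * a + i * shift (v ⊕ suc a · unit d)             <⟨ +-monoˡ-< (i * shift (v ⊕ suc a · unit d))
                                                            (≤-<-trans (*-monoˡ-≤ a i≤j) (*-monoʳ-< j (n<1+n a))) ⟩
    j * suc a + i * shift (v ⊕ suc a · unit d)         ∎))
    where open ≤-Reasoning

  apart : ∀ {v w} → v ∈ nodes A → w ∈ nodes A → ∀ i j → i ≤ j → 0 < j →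
    j · v ⊕ i · δ v ≡ j · w ⊕ i · δ w → v ≡ w
  apart {v} {w} v∈ w∈ i j i≤j 0<j eq = go (align d j 0<j (subst₂ _≡_ (scale v) (scale w) eq))
    where
    scale : ∀ p → j · p ⊕ i · δ p ≡ j · p ⊕ (i * shift p) · unit d
    scale p = cong (j · p ⊕_) (sym (·-·-assoc i (shift p) (unit d)))
    go : Aligned d j (i * shift v) (i * shift w) v w → v ≡ w
    go (before c refl eq) = not-behind i j c i≤j 0<j v∈ w∈ eq
    go (after c refl eq)  = sym (not-behind i j c i≤j 0<j w∈ v∈ eq)

  end-apart : ∀ {v w} → v ∈ nodes A → w ∈ nodes A → moved v ≡ moved w → v ≡ w
  end-apart {v} {w} v∈ w∈ eq = apart v∈ w∈ 1 1 ≤-refl ≤-refl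
    (trans (unscale v) (trans eq (sym (unscale w))))
    where
    unscale : ∀ p → 1 · p ⊕ 1 · δ p ≡ moved p
    unscale p = cong₂ _⊕_ (1·-identity p) (1·-identity (δ p))

  -- The created node ends where `u` would with one more unit of shift, and only end positions
  -- matter, so `align` is used with `j = 1`. In the case `before` the node `w` would have overtaken
  -- `u`; in the case `after` the bit of `u` is 1 and `order` at `u` leaves room for the created
  -- node.
  old≢new : ∀ {w u} → w ∈ nodes A → T (receives u) → moved w ≢ created u
  old≢new {w} {u} w∈ r eq = go (align d 1 {shift w} {suc (shift u)} {w} {u} ≤-refl
    (trans (cong (_⊕ δ w) (1·-identity w))
      (trans eq (trans (created≡ u) (cong (_⊕ suc (shift u) · unit d) (sym (1·-identity u)))))))
    where
    go : ¬ Aligned d 1 (shift w) (suc (shift u)) w u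
    go (before zero refl h) = contradiction (trans h (cong (suc ∘ shift) (⊕-0· w (unit d))))
      (<⇒≢ (n<1+n (shift w)))
    go (before (suc a) refl h) = contradiction h (<⇒≢ (≤-trans (≤-order a w∈ (on-nodes r))
      (+-mono-≤ (≤-reflexive (sym (*-identityˡ (suc a)))) (n≤1+n _))))
    go (after zero refl h) = contradiction (trans h (cong shift (⊕-0· u (unit d))))
      (<⇒≢ (n<1+n (shift u)) ∘ sym)
    go (after (suc a) refl h) = contradiction h (<⇒≢ (≤-trans (s≤s (≤-reflexive
      (trans (+-comm 1 (shift u)) (cong (λ b → shift u + b) (sym (T⇒bit≡1 r))))))
      (≤-trans (order a (on-nodes r) w∈) (+-monoˡ-≤ _ (≤-reflexive (sym (*-identityˡ (suc a))))))))

  module _ (cells : List Point) (unique : Unique cells) (cells⇔ : ∀ p → p ∈ cells ⇔ NewNode p) where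

    open Equivalence

    -- The list of cells is a parameter because distinctness is easiest to get outside, by filtering
    -- the nodes of the target shape.
    result : Shape
    result = record
      { nodes     = cells
      ; distinct  = unique
      ; Edge      = SymClosure NewEdge
      ; edge-sym  = Sym.symmetric NewEdge
      ; edge-node = λ { {p} (fwd e) → from (cells⇔ p) (proj₁ (newEdge-nodes e))
                      ; {p} (bwd e) → from (cells⇔ p) (proj₂ (newEdge-nodes e)) }
      ; edge-adj  = λ { (fwd e) → newEdge-adjacent e
                      ; {p} {q} (bwd e) → Adjacent-sym {q} {p} (newEdge-adjacent e) }
      ; connected = λ {p} {q} p∈ q∈ → link-root (to (cells⇔ p) p∈) ◅◅ link-sym (link-root (to (cells⇔ q) q∈))
      }

    growthStep : GrowthStep root A result
    growthStep = record
      { direction        = d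
      ; receives         = receives
      ; on-nodes         = on-nodes
      ; tree             = tree
      ; δ                = δ
      ; δ-path           = λ {w} p → sym (trans (displacement≡ (SpanningTree.child-edge tree) p)
          (trans (cong (λ n → δ w ⊖ n · unit d) shift-root)
            (trans (cong (δ w ⊖_) (0·-zero (unit d))) (p⊖𝟎≡p (δ w)))))
      ; cycle-consistent = λ p q _ →
          trans (displacement≡ id p) (sym (displacement≡ id (Star.reverse (edge-sym A) q)))
      ; no-collision     = record
          { during      = apart
          ; end-old-old = end-apart
          ; end-old-new = old≢new
          ; end-new-new = λ r r′ eq → end-apart (on-nodes r) (on-nodes r′) (⊕-cancelʳ (unit d) eq)
          }
      ; nodes-after      = cells⇔
      ; edges-after      = λ p q → mk⇔ id id
      }
      where
      tree = BreadthFirst.spanningTree A induced root root∈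

-- Regions of the target shape and growth between them.

does-yes : ∀ {A : Set} (a? : Dec A) → A → does a? ≡ true
does-yes (yes _) _ = refl
does-yes (no ¬a) a = contradiction a ¬a

does-no : ∀ {A : Set} (a? : Dec A) → ¬ A → does a? ≡ false
does-no (yes a) ¬a = contradiction a ¬a
does-no (no _)  _  = refl

T-does⇒ : ∀ {A : Set} (a? : Dec A) → T (does a?) → A
T-does⇒ (yes a) _ = a

⇒T-does : ∀ {A : Set} (a? : Dec A) → A → T (does a?)
⇒T-does a? a = subst T (sym (does-yes a? a)) _

bit≤1 : ∀ b → bit b ≤ 1
bit≤1 false = z≤n
bit≤1 true  = ≤-refl

module Growth (S : Shape) (root : Point) where

  record Region : Set₁ where
    field
      In      : Pred Point 0ℓ
      in?     : Decidable In
      in-S    : ∀ {p} → In p → p ∈ nodes S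
      in-root : In root

  open Region public

  -- With `Induced`, the cells determine the edges, so nothing about the shape needs to be
  -- remembered besides the predicate.
  Grown : ℕ → Pred Point 0ℓ → Set₁
  Grown t P = ∃ λ A → Process root (singleNode root) t A × Induced A × (∀ p → p ∈ nodes A ⇔ P p)

  grown-resp : ∀ {t P Q} → (∀ {p} → P p → Q p) → (∀ {p} → Q p → P p) → Grown t P → Grown t Q
  grown-resp P⊆Q Q⊆P (A , process , induced , nodes⇔) =
    A , process , induced , λ p → mk⇔ (P⊆Q ∘ to (nodes⇔ p)) (from (nodes⇔ p) ∘ Q⊆P)
    where open Equivalence

  module _ (X Y : Region) {d : Direction} (push : Push (In X) root d) where

    open Push push

    grow : (∀ {w} → In X w → In Y (w ⊕ shift w · unit d)) →
      (∀ {u} → T (receives u) → In Y (u ⊕ suc (shift u) · unit d)) →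
      (∀ {p} → In Y p → (∃ λ w → In X w × p ≡ w ⊕ shift w · unit d) ⊎
                        (∃ λ u → T (receives u) × p ≡ u ⊕ suc (shift u) · unit d)) →
      ∀ {t} → Grown t (In X) → Grown (suc t) (In Y)
    grow old-lands new-lands origin (A , process , induced , nodes⇔) =
      AC B , step process (PushStep.growthStep {A} induced root∈ pushA cells unique cells⇔) ,
      (λ p∈ q∈ adj → inj₂ (p∈ , q∈ , adj)) ,
      λ p → mk⇔ (proj₂ ∘ ∈-filter⁻ (in? Y) {xs = nodes S}) (λ y → ∈-filter⁺ (in? Y) (in-S Y y) y)
      where
      open Equivalence
      root∈ : root ∈ nodes A
      root∈ = from (nodes⇔ root) (in-root X)

      inX : ∀ {p} → p ∈ nodes A → In X p
      inX {p} = to (nodes⇔ p)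

      pushA : Push (_∈ nodes A) root d
      pushA = record
        { receives   = receives
        ; on-nodes   = λ {u} r → from (nodes⇔ u) (on-nodes r)
        ; shift      = shift
        ; shift-root = shift-root
        ; along      = λ u∈ v∈ → along (inX u∈) (inX v∈)
        ; across     = λ u∈ v∈ → across (inX u∈) (inX v∈)
        ; order      = λ a u∈ v∈ → order a (inX u∈) (inX v∈)
        }

      open PushStep {A} induced root∈ pushA using (created≡; δ)
      open Operations.Result A d receives δ using (NewNode; old; new)

      cells : List Point
      cells = filter (in? Y) (nodes S)

      unique : Unique cells
      unique = filter⁺ (in? Y) (distinct S)

      lands : ∀ {p} → NewNode p → In Y p
      lands (old w∈)    = old-lands (inX w∈)
      lands (new {u} r) = subst (In Y) (sym (created≡ u)) (new-lands r)

      comes : ∀ {p} → In Y p → NewNode p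
      comes y with origin y
      ... | inj₁ (w , x , refl) = old (from (nodes⇔ w) x)
      ... | inj₂ (u , r , refl) = subst NewNode (created≡ u) (new r)

      cells⇔ : ∀ p → p ∈ cells ⇔ NewNode p
      cells⇔ p = mk⇔ (comes ∘ proj₂ ∘ ∈-filter⁻ (in? Y) {xs = nodes S})
        (λ y → ∈-filter⁺ (in? Y) (in-S Y (lands y)) (lands y))

      B : Shape
      B = PushStep.result {A} induced root∈ pushA cells unique cells⇔

  module _ (X : Region) (d : Direction) {R : Pred Point 0ℓ} (R? : Decidable R)
    (R⊆S : ∀ {p} → R p → p ∈ nodes S) where

    attach : Region
    attach = record
      { In      = λ w → In X w ⊎ (R w × In X (w ⊕ unit (opposite d)))
      ; in?     = λ w → in? X w ⊎-dec (R? w ×-dec in? X (w ⊕ unit (opposite d)))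
      ; in-S    = [ in-S X , R⊆S ∘ proj₁ ]′
      ; in-root = inj₁ (in-root X)
      }

    private
      Sprouts : Pred Point 0ℓ
      Sprouts u = In X u × R (u ⊕ unit d) × ¬ In X (u ⊕ unit d)

      sprouts? : Decidable Sprouts
      sprouts? u = in? X u ×-dec (R? (u ⊕ unit d) ×-dec ¬? (in? X (u ⊕ unit d)))

      push : Push (In X) root d
      push = record
        { receives   = does ∘ sprouts?
        ; on-nodes   = λ {u} r → proj₁ (T-does⇒ (sprouts? u) r)
        -- Operations are directed only at unoccupied cells, so no edge is split and no node is
        -- displaced.
        ; shift      = λ _ → 0
        ; shift-root = refl
        ; along      = λ {u} _ v∈ → sym (inert v∈)
        ; across     = λ _ _ → refl
        ; order      = order
        }
        where
        inert : ∀ {u} → In X (u ⊕ unit d) → bit (does (sprouts? u)) ≡ 0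
        inert {u} v∈ = cong bit (does-no (sprouts? u) (λ (_ , _ , v∉) → v∉ v∈))

        order : ∀ {u} a → In X u → In X (u ⊕ suc a · unit d) → bit (does (sprouts? u)) < suc a + 0
        order {u} zero    _ v∈ = s≤s (≤-reflexive (inert (subst (In X) (⊕-1· u (unit d)) v∈)))
        order {u} (suc a) _ _  = s≤s (≤-trans (bit≤1 _) (s≤s z≤n))

    grow-attach : ∀ {t} → Grown t (In X) → Grown (suc t) (In attach)
    grow-attach = grow X attach push
      (λ {w} x → inj₁ (subst (In X) (sym (⊕-0· w (unit d))) x))
      (λ {u} r → let x , rv , _ = T-does⇒ (sprouts? u) r
                 in subst (In attach) (sym (⊕-1· u (unit d)))
                      (inj₂ (rv , subst (In X) (sym (forth-back d u)) x)))
      origin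
      where
      origin : ∀ {p} → In attach p → (∃ λ w → In X w × p ≡ w ⊕ 0 · unit d) ⊎
                                     (∃ λ u → T (does (sprouts? u)) × p ≡ u ⊕ 1 · unit d)
      origin {p} y with in? X p | y
      ... | yes x | _             = inj₁ (p , x , sym (⊕-0· p (unit d)))
      ... | no ¬x | inj₁ x        = contradiction x ¬x
      ... | no ¬x | inj₂ (r , x) = inj₂ (u , ⇒T-does (sprouts? u) (x , subst R (sym u⊕) r , subst (¬_ ∘ In X) (sym u⊕) ¬x) ,
                                         sym (trans (⊕-1· u (unit d)) u⊕))
        where
        u = p ⊕ unit (opposite d)
        u⊕ : u ⊕ unit d ≡ p
        u⊕ = back-forth d p

-- Lengths of runs of cells.

·unit-injective : ∀ d {m n} → m · unit d ≡ n · unit d → m ≡ n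
·unit-injective north eq = ℤₚ.+-injective (ℤₚ.*-cancelʳ-≡ _ _ (+ 1) (cong proj₂ eq))
·unit-injective east  eq = ℤₚ.+-injective (ℤₚ.*-cancelʳ-≡ _ _ (+ 1) (cong proj₁ eq))
·unit-injective south eq = ℤₚ.+-injective (ℤₚ.*-cancelʳ-≡ _ _ -[1+ 0 ] (cong proj₂ eq))
·unit-injective west  eq = ℤₚ.+-injective (ℤₚ.*-cancelʳ-≡ _ _ -[1+ 0 ] (cong proj₁ eq))

module Runs {F : Pred Point 0ℓ} (F? : Decidable F) (ps : List Point) (F⊆ps : ∀ {p} → F p → p ∈ ps) where

  private
    N : ℕ
    N = length ps

    count : ℕ → Direction → Point → ℕ
    count zero    d w = 0
    count (suc n) d w with F? (w ⊕ unit d)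
    ... | yes _ = suc (count n d (w ⊕ unit d))
    ... | no _  = 0

    count-F : ∀ n d w j → j < count n d w → F (w ⊕ suc j · unit d)
    count-F (suc n) d w j j< with F? (w ⊕ unit d)
    count-F (suc n) d w zero    _        | yes f = subst F (sym (⊕-1· w (unit d))) f
    count-F (suc n) d w (suc j) (s≤s j<) | yes f =
      subst F (trans (⊕-swapʳ w (unit d) _) (sym (⊕-suc· w (suc j) (unit d)))) (count-F n d (w ⊕ unit d) j j<)

    -- Pigeonhole: the counted cells are distinct members of `ps`, so their indices in the list are
    -- distinct.
    count≤N : ∀ n d w → count n d w ≤ N
    count≤N n d w = Finₚ.injective⇒≤ {f = position} injective
      where
      cell : ∀ (i : Fin (count n d w)) → (w ⊕ suc (Fin.toℕ i) · unit d) ∈ ps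
      cell i = F⊆ps (count-F n d w (Fin.toℕ i) (Finₚ.toℕ<n i))
      position : Fin (count n d w) → Fin N
      position i = Any.index (cell i)
      injective : ∀ {i j} → position i ≡ position j → i ≡ j
      injective {i} {j} eq = Finₚ.toℕ-injective (suc-injective (·unit-injective d (⊕-cancelˡ w
        (trans (lookup-index (cell i)) (trans (cong (lookup ps) eq) (sym (lookup-index (cell j))))))))

    -- A count below its fuel has stopped at a cell outside `F`, so further fuel changes nothing.
    count-stable : ∀ n d w → count n d w < n → count (suc n) d w ≡ count n d w
    count-stable (suc n) d w c< with F? (w ⊕ unit d)
    ... | yes _ = cong suc (count-stable n d (w ⊕ unit d) (≤-pred c<))
    ... | no _  = refl

  abstract

    -- The number of consecutive cells of F that follow w in direction d; a run
    -- has at most N cells, so the fuel never runs out.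
    ahead-of : Direction → Point → ℕ
    ahead-of d w = count (suc N) d w

    ahead-of≤ : ∀ d w → ahead-of d w ≤ N
    ahead-of≤ = count≤N (suc N)

    ahead-of-suc : ∀ d w → F (w ⊕ unit d) → ahead-of d w ≡ suc (ahead-of d (w ⊕ unit d))
    -- The bound is named before the case distinction on `F?`, so that the latter also unfolds the
    -- count in its type and yields the strict inequality for fuel `N`.
    ahead-of-suc d w f with count≤N (suc N) d w
    ... | bound with F? (w ⊕ unit d)
    ...   | yes _ = cong suc (sym (count-stable N d (w ⊕ unit d) bound))
    ...   | no ¬f = contradiction f ¬f

    ahead-of-zero : ∀ d w → ¬ F (w ⊕ unit d) → ahead-of d w ≡ 0
    ahead-of-zero d w ¬f with F? (w ⊕ unit d)
    ... | yes f = contradiction f ¬f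
    ... | no _  = refl

  -- v lies j cells after w in the same run.
  record Climbed (d d′ : Direction) (j : ℕ) (w v : Point) : Set where
    constructor climbed
    field
      reached : F v
      passed  : ahead-of d′ v ≡ j + ahead-of d′ w
      beyond  : ahead-of d w ≡ j + ahead-of d v

  module _ (d d′ : Direction) (inverse : ∀ p → (p ⊕ unit d) ⊕ unit d′ ≡ p) where

    -- With both directions as parameters, one induction serves upwards, to see where a node lands,
    -- and downwards, to see where a cell comes from.
    climb : ∀ {w} j → F w → j ≤ ahead-of d w → Climbed d d′ j w (w ⊕ j · unit d)
    climb {w} zero    f _  = subst (Climbed d d′ 0 w) (sym (⊕-0· w (unit d))) (climbed f refl refl)
    climb {w} (suc j) f j< = subst (Climbed d d′ (suc j) w) (sym (⊕-suc· w j (unit d)))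
      (next (climb j f (<⇒≤ j<)) (F? (v ⊕ unit d)))
      where
      v = w ⊕ j · unit d
      next : Climbed d d′ j w v → Dec (F (v ⊕ unit d)) → Climbed d d′ (suc j) w (v ⊕ unit d)
      next (climbed fv passed beyond) (yes f′) = climbed f′
        (trans (ahead-of-suc d′ (v ⊕ unit d) (subst F (sym (inverse v)) fv))
          (cong suc (trans (cong (ahead-of d′) (inverse v)) passed)))
        (trans beyond (trans (cong (λ n → j + n) (ahead-of-suc d v f′)) (+-suc j _)))
      next (climbed _ _ beyond) (no ¬f′) = contradiction j< (≤⇒≯ (≤-reflexive
        (trans beyond (trans (cong (λ n → j + n) (ahead-of-zero d v ¬f′)) (+-identityʳ j)))))

-- Doubling all runs in one step.

halve : ∀ n → ∃ λ i → n ≡ i + i ⊎ n ≡ suc (i + i)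
halve zero    = 0 , inj₁ refl
halve (suc n) with halve n
... | i , inj₁ eq = i , inj₂ (cong suc eq)
... | i , inj₂ eq = suc i , inj₁ (cong suc (trans eq (sym (+-suc i i))))

module Doubling (S : Shape) (root : Point) (d : Direction) (X : Growth.Region S root)
  {F : Pred Point 0ℓ} (F? : Decidable F) (F⊆S : ∀ {p} → F p → p ∈ nodes S)
  (disjoint : ∀ {p} → F p → ¬ Growth.In X p)
  (isolated-right : ∀ {p} → F p → ¬ (Growth.In X (p ⊕ unit (clockwise d)) ⊎ F (p ⊕ unit (clockwise d))))
  (isolated-left : ∀ {p} → F (p ⊕ unit (clockwise d)) → ¬ (Growth.In X p ⊎ F p))
  where

  open Growth S root
  open Runs F? (nodes S) F⊆S

  pos up : Point → ℕ
  pos = ahead-of (opposite d)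
  up  = ahead-of d

  -- Runs of F shrunk by the factor g: a run of length m keeps the positions
  -- i with g i < m, where m = pos w + up w + 1 for w in the run.
  Stage : ℕ → Pred Point 0ℓ
  Stage g w = In X w ⊎ (F w × g * pos w ≤ pos w + up w)

  stage : ℕ → Region
  stage g = record
    { In      = Stage g
    ; in?     = λ w → in? X w ⊎-dec (F? w ×-dec (g * pos w ≤? pos w + up w))
    ; in-S    = [ in-S X , F⊆S ∘ proj₁ ]′
    ; in-root = inj₁ (in-root X)
    }

  shift : Point → ℕ
  shift w = if does (F? w) then pos w else 0

  shift-F : ∀ {w} → F w → shift w ≡ pos w
  shift-F {w} f = cong (if_then pos w else 0) (does-yes (F? w) f)

  shift-X : ∀ {w} → In X w → shift w ≡ 0
  shift-X {w} x = cong (if_then pos w else 0) (does-no (F? w) (λ f → disjoint f x))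

  pos-suc : ∀ {u} → F u → pos (u ⊕ unit d) ≡ suc (pos u)
  pos-suc {u} f = trans (ahead-of-suc (opposite d) (u ⊕ unit d) (subst F (sym (forth-back d u)) f))
    (cong (suc ∘ pos) (forth-back d u))

  pos-zero : ∀ {u} → ¬ F u → pos (u ⊕ unit d) ≡ 0
  pos-zero {u} ¬f = ahead-of-zero (opposite d) (u ⊕ unit d) (¬f ∘ subst F (forth-back d u))

  module _ (h : ℕ) (1≤h : 1 ≤ h) where

    -- The condition for position `2i + 1` to belong to scale `h`, where `i = pos u`. Only the
    -- topmost present node of a run can fail it, which accounts for runs whose next length is odd;
    -- so runs of all lengths stay in step.
    Grows : Pred Point 0ℓ
    Grows u = F u × h * suc (pos u + pos u) ≤ pos u + up u

    grows? : Decidable Grows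
    grows? u = F? u ×-dec (h * suc (pos u + pos u) ≤? pos u + up u)

    2h*p : ∀ p → 2 * h * p ≡ h * (p + p)
    2h*p p = begin
      2 * h * p        ≡⟨ cong (_* p) (*-comm 2 h) ⟩
      h * 2 * p        ≡⟨ *-assoc h 2 p ⟩
      h * (p + (p + 0)) ≡⟨ cong (λ q → h * (p + q)) (+-identityʳ p) ⟩
      h * (p + p)      ∎
      where open ≡-Reasoning

    m≤h*m : ∀ m → m ≤ h * m
    m≤h*m m = ≤-trans (≤-reflexive (sym (*-identityˡ m))) (*-monoˡ-≤ m 1≤h)

    -- A node present at scale `2 * h` lies in the lower half of its full run, so its doubled
    -- position is still in the run; `pos<up` is the same for the created node at `2i + 1`.
    pos≤up : ∀ w → 2 * h * pos w ≤ pos w + up w → pos w ≤ up w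
    pos≤up w le = +-cancelˡ-≤ (pos w) _ _
      (≤-trans (m≤h*m (pos w + pos w)) (≤-trans (≤-reflexive (sym (2h*p (pos w)))) le))

    pos<up : ∀ w → h * suc (pos w + pos w) ≤ pos w + up w → pos w < up w
    pos<up w le = +-cancelˡ-≤ (pos w) _ _
      (≤-trans (≤-reflexive (+-suc (pos w) (pos w))) (≤-trans (m≤h*m _) le))

    bit-grows : ∀ {u} → Grows u → bit (does (grows? u)) ≡ 1
    bit-grows {u} g = cong bit (does-yes (grows? u) g)

    bit-rests : ∀ {u} → ¬ Grows u → bit (does (grows? u)) ≡ 0
    bit-rests {u} ¬g = cong bit (does-no (grows? u) ¬g)

    -- From `X` into a run the shift stays 0, since the bottom of a run has position 0. If `X` lies
    -- directly above a present run node, that node is a whole run by itself and rests. Between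
    -- consecutive run nodes the shift rises by one, so the lower must receive an operation: if
    -- `i + 1` is present at scale `2 * h`, then `2i + 1` belongs to scale `h`.
    along : ∀ {u} → Stage (2 * h) u → Stage (2 * h) (u ⊕ unit d) →
      shift (u ⊕ unit d) ≡ shift u + bit (does (grows? u))
    along {u} (inj₁ x) y = trans (shift-v y)
      (sym (cong₂ _+_ (shift-X x) (bit-rests (λ (f , _) → disjoint f x))))
      where
      shift-v : Stage (2 * h) (u ⊕ unit d) → shift (u ⊕ unit d) ≡ 0
      shift-v (inj₁ x′)      = shift-X x′
      shift-v (inj₂ (f , _)) = trans (shift-F f) (pos-zero (λ f′ → disjoint f′ x))
    along {u} (inj₂ (f , le)) (inj₁ x) =
      trans (shift-X x) (sym (cong₂ _+_ (trans (shift-F f) pos≡0) (bit-rests ¬grows)))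
      where
      up≡0 : up u ≡ 0
      up≡0 = ahead-of-zero d u (λ f′ → disjoint f′ x)
      pos≡0 : pos u ≡ 0
      pos≡0 = n≤0⇒n≡0 (≤-trans (pos≤up u le) (≤-reflexive up≡0))
      ¬grows : ¬ Grows u
      ¬grows (_ , le′) = n≮0 (≤-trans (pos<up u le′) (≤-reflexive up≡0))
    along {u} (inj₂ (f , _)) (inj₂ (f′ , le)) = begin
      shift (u ⊕ unit d)                 ≡⟨ shift-F f′ ⟩
      pos (u ⊕ unit d)                   ≡⟨ pos-suc f ⟩
      suc (pos u)                        ≡⟨ +-comm 1 (pos u) ⟩
      pos u + 1                          ≡⟨ cong₂ _+_ (shift-F f) (bit-grows (f , grows)) ⟨
      shift u + bit (does (grows? u))    ∎
      where
      open ≡-Reasoning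
      grows : h * suc (pos u + pos u) ≤ pos u + up u
      grows = ≤-trans (*-monoʳ-≤ h (s≤s (+-monoʳ-≤ (pos u) (n≤1+n (pos u)))))
        (subst₂ _≤_ (trans (2h*p (pos (u ⊕ unit d))) (cong (λ p → h * (p + p)) (pos-suc f)))
          (trans (cong (_+ up (u ⊕ unit d)) (pos-suc f))
            (trans (sym (+-suc (pos u) (up (u ⊕ unit d)))) (cong (λ m → pos u + m) (sym (ahead-of-suc d u f′))))) le)

    across : ∀ {u} → Stage (2 * h) u → Stage (2 * h) (u ⊕ unit (clockwise d)) →
      shift (u ⊕ unit (clockwise d)) ≡ shift u
    across (inj₁ x) (inj₁ y)       = trans (shift-X y) (sym (shift-X x))
    across (inj₁ x) (inj₂ (f , _)) = contradiction (inj₁ x) (isolated-left f)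
    across (inj₂ (f , _)) (inj₁ y) = contradiction (inj₁ y) (isolated-right f)
    across (inj₂ (f , _)) (inj₂ (f′ , _)) = contradiction (inj₂ f′) (isolated-right f)

    -- A target inside the run of `u` has a larger position and hence a larger shift. A target
    -- beyond the run is more than `up u` away, and neither `u` nor the node it creates leaves the
    -- run.
    order : ∀ {u} a → Stage (2 * h) u → Stage (2 * h) (u ⊕ suc a · unit d) →
      shift u + bit (does (grows? u)) < suc a + shift (u ⊕ suc a · unit d)
    order {u} a (inj₁ x) _ = s≤s (≤-trans (≤-reflexive
      (cong₂ _+_ (shift-X x) (bit-rests (λ (f , _) → disjoint f x)))) z≤n)
    order {u} a (inj₂ (f , le)) _ with suc a ≤? up u
    ... | yes a< with climbed f′ below _ ← climb d (opposite d) (forth-back d) (suc a) f a< = begin-strict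
      shift u + bit (does (grows? u))               ≤⟨ +-mono-≤ (≤-reflexive (shift-F f)) (bit≤1 _) ⟩
      pos u + 1                                     ≡⟨ +-comm (pos u) 1 ⟩
      suc (pos u)                                   ≤⟨ s≤s (m≤n+m (pos u) a) ⟩
      suc a + pos u                                 ≡⟨ below ⟨
      pos (u ⊕ suc a · unit d)                      <⟨ m<n+m _ (s≤s z≤n) ⟩
      suc a + pos (u ⊕ suc a · unit d)              ≡⟨ cong (λ n → suc a + n) (shift-F f′) ⟨
      suc a + shift (u ⊕ suc a · unit d)            ∎
      where open ≤-Reasoning
    ... | no a≮ = ≤-<-trans (≤-trans (≤-reflexive (cong (_+ bit (does (grows? u))) (shift-F f))) stays)
                    (<-≤-trans (≰⇒> a≮) (m≤m+n (suc a) _))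
      where
      stays : pos u + bit (does (grows? u)) ≤ up u
      stays with grows? u
      ... | yes g = ≤-trans (≤-reflexive (trans (cong (λ n → pos u + n) (bit-grows g)) (+-comm (pos u) 1)))
                      (pos<up u (proj₂ g))
      ... | no ¬g = ≤-trans (≤-reflexive (trans (cong (λ n → pos u + n) (bit-rests ¬g)) (+-identityʳ (pos u))))
                      (pos≤up u le)

    push : Push (Stage (2 * h)) root d
    push = record
      { receives   = does ∘ grows?
      ; on-nodes   = λ {u} r → let f , le = T-does⇒ (grows? u) r in
          inj₂ (f , ≤-trans (≤-reflexive (2h*p (pos u))) (≤-trans (*-monoʳ-≤ h (n≤1+n _)) le))
      ; shift      = shift
      ; shift-root = shift-X (in-root X)
      ; along      = along
      ; across     = across
      ; order      = order
      }

    -- Climbing preserves `pos + up`, the length of the run less one, while the position doubles;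
    -- `2 * h * i` and `h * (i + i)` then express the same bound.
    old-lands : ∀ {w} → Stage (2 * h) w → Stage h (w ⊕ shift w · unit d)
    old-lands {w} (inj₁ x) = inj₁ (subst (In X) (sym (trans (cong (λ n → w ⊕ n · unit d) (shift-X x)) (⊕-0· w (unit d)))) x)
    old-lands {w} (inj₂ (f , le))
      with climbed f′ below above ← climb d (opposite d) (forth-back d) (pos w) f (pos≤up w le)
      = subst (λ n → Stage h (w ⊕ n · unit d)) (sym (shift-F f)) (inj₂ (f′ , subst₂ _≤_ (trans (2h*p (pos w)) (cong (λ n → h * n) (sym below)))
          (trans (cong (λ n → pos w + n) above) (trans (sym (+-assoc (pos w) (pos w) _)) (cong (_+ up (w ⊕ pos w · unit d)) (sym below)))) le))

    new-lands : ∀ {u} → T (does (grows? u)) → Stage h (u ⊕ suc (shift u) · unit d)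
    new-lands {u} r with T-does⇒ (grows? u) r
    ... | f , le
      with climbed f′ below above ← climb d (opposite d) (forth-back d) (suc (pos u)) f (pos<up u le)
      = subst (λ n → Stage h (u ⊕ suc n · unit d)) (sym (shift-F f)) (inj₂ (f′ , subst₂ _≤_ (cong (λ n → h * n) (sym below))
          (trans (cong (λ n → pos u + n) above) (trans (sym (+-assoc (pos u) (suc (pos u)) _))
            (cong (_+ up (u ⊕ suc (pos u) · unit d)) (trans (+-suc (pos u) (pos u)) (sym below))))) le))

    descend : ∀ j w → (w ⊕ j · unit (opposite d)) ⊕ j · unit d ≡ w
    descend j w = begin
      (w ⊕ j · unit (opposite d)) ⊕ j · unit d   ≡⟨ ⊕-assoc w _ _ ⟩
      w ⊕ (j · unit (opposite d) ⊕ j · unit d)   ≡⟨ cong (w ⊕_) (⊕-comm _ (j · unit d)) ⟩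
      w ⊕ (j · unit d ⊕ j · unit (opposite d))   ≡⟨ cong (w ⊕_) (·-distribˡ-⊕ j (unit d) (unit (opposite d))) ⟨
      w ⊕ j · (unit d ⊕ unit (opposite d))       ≡⟨ cong (λ p → w ⊕ j · p) (unit-opposite d) ⟩
      w ⊕ j · 𝟎                                  ≡⟨ cong (w ⊕_) (cong₂ _,_ (ℤₚ.*-zeroʳ (+ j)) (ℤₚ.*-zeroʳ (+ j))) ⟩
      w ⊕ 𝟎                                      ≡⟨ ⊕-identityʳ w ⟩
      w                                          ∎
      where open ≡-Reasoning

    -- The parity of the position decides: `2i` is the image of the node at `i`, found `i` cells
    -- lower, and `2i + 1` was created from the node at `i`, found `suc i` cells lower.
    origin : ∀ {p} → Stage h p →
      (∃ λ w → Stage (2 * h) w × p ≡ w ⊕ shift w · unit d) ⊎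
      (∃ λ u → T (does (grows? u)) × p ≡ u ⊕ suc (shift u) · unit d)
    origin {p} (inj₁ x) =
      inj₁ (p , inj₁ x , sym (trans (cong (λ n → p ⊕ n · unit d) (shift-X x)) (⊕-0· p (unit d))))
    origin {p} (inj₂ (f , le)) with halve (pos p)
    ... | i , inj₁ even with climbed f′ above below ←
          climb (opposite d) d (back-forth d) i f (≤-trans (m≤m+n i i) (≤-reflexive (sym even)))
        = inj₁ (w , inj₂ (f′ , subst₂ _≤_
            (trans (cong (λ n → h * n) even) (sym (trans (2h*p (pos w)) (cong (λ n → h * (n + n)) pos≡))))
            (trans (cong (_+ up p) even) (trans (+-assoc i i (up p)) (cong₂ _+_ (sym pos≡) (sym above)))) le) ,
            sym (trans (cong (λ n → w ⊕ n · unit d) (trans (shift-F f′) pos≡)) (descend i p)))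
      where
      w = p ⊕ i · unit (opposite d)
      pos≡ : pos w ≡ i
      pos≡ = +-cancelˡ-≡ i _ _ (trans (sym below) even)
    ... | i , inj₂ odd with climbed f′ above below ←
          climb (opposite d) d (back-forth d) (suc i) f (≤-trans (s≤s (m≤m+n i i)) (≤-reflexive (sym odd)))
        = inj₂ (u , ⇒T-does (grows? u) (f′ , subst₂ _≤_
            (cong (λ n → h * n) (trans odd (cong (λ n → suc (n + n)) (sym pos≡))))
            (trans (cong (_+ up p) odd) (trans (cong (_+ up p) (sym (+-suc i i)))
              (trans (+-assoc i (suc i) (up p)) (cong₂ _+_ (sym pos≡) (sym above))))) le) ,
            sym (trans (cong (λ n → u ⊕ suc n · unit d) (trans (shift-F f′) pos≡)) (descend (suc i) p)))
      where
      u = p ⊕ suc i · unit (opposite d)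
      pos≡ : pos u ≡ i
      pos≡ = +-cancelˡ-≡ (suc i) _ _ (trans (sym below) odd)

    double : ∀ {t} → Grown t (Stage (2 * h)) → Grown (suc t) (Stage h)
    double = grow (stage (2 * h)) (stage h) push old-lands new-lands origin

  double* : ∀ m {t} → Grown t (Stage (2 ^ m)) → Grown (m + t) (Stage 1)
  double* zero    g = g
  double* (suc m) {t} g = subst (λ n → Grown n (Stage 1)) (+-suc m t)
    (double* m (double (2 ^ m) (m^n>0 2 m) g))

-- Adding a set of lines no two of which are side by side.

opposite-involutive : ∀ d → opposite (opposite d) ≡ d
opposite-involutive north = refl
opposite-involutive east  = refl
opposite-involutive south = refl
opposite-involutive west  = refl

-- Used with `suc p` a positive position, `q` the number of cells above it and `m = 2 ^ K`. Only `q`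
-- is bounded by the size, and the factor 2 absorbs the position itself; hence the initial scale
-- `2 ^ suc K`.
1+m+n<2m*n : ∀ n p q {m} → 2 ≤ n → q ≤ n → n ≤ m → suc p + q < 2 * m * suc p
1+m+n<2m*n n p q {m} 2≤n q≤n n≤m = begin-strict
  suc p + q             ≤⟨ +-monoʳ-≤ (suc p) (≤-trans q≤n n≤m) ⟩
  suc p + m             <⟨ +-monoˡ-< m (m<m*n (suc p) m (≤-trans 2≤n n≤m)) ⟩
  suc p * m + m         ≤⟨ +-monoʳ-≤ (suc p * m) (m≤m*n m (suc p)) ⟩
  suc p * m + m * suc p ≡⟨ cong (_+ m * suc p) (*-comm (suc p) m) ⟩
  m * suc p + m * suc p ≡⟨ *-distribʳ-+ (suc p) m m ⟨
  (m + m) * suc p       ≡⟨ cong (λ k → (m + k) * suc p) (+-identityʳ m) ⟨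
  2 * m * suc p         ∎
  where open ≤-Reasoning

module Columns (S : Shape) (root : Point) (K : ℕ) (2≤size : 2 ≤ size S) (size≤2^K : size S ≤ 2 ^ K) where

  open Growth S root

  -- Cells of R beside X are attached sideways; what is left of R then consists
  -- of isolated lines, which can be stretched without moving anything else.
  module _ (X : Region) (d : Direction) {R : Pred Point 0ℓ} (R? : Decidable R)
    (R⊆S : ∀ {p} → R p → p ∈ nodes S)
    (closed : ∀ {w} → R w → R (w ⊕ unit (opposite d)) ⊎ In X (w ⊕ unit (opposite d)))
    (sparse : ∀ {w} → R w → ¬ R (w ⊕ unit (clockwise d))) where

    union : Region
    union = record
      { In      = λ w → In X w ⊎ R w
      ; in?     = λ w → in? X w ⊎-dec R? w
      ; in-S    = [ in-S X , R⊆S ]′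
      ; in-root = inj₁ (in-root X)
      }

    private
      X₁ X₂ X₃ : Region
      -- Cells of `R` to the right of `X`, then those to the left, then the first cell of each
      -- remaining run. By sparseness the second step gains nothing from the cells added in the
      -- first.
      X₁ = attach X (clockwise d) R? R⊆S
      X₂ = attach X₁ (opposite (clockwise d)) R? R⊆S
      X₃ = attach X₂ d R? R⊆S

      X₂⊆ : ∀ {w} → In X₂ w → In X w ⊎ R w
      X₂⊆ (inj₁ (inj₁ x))       = inj₁ x
      X₂⊆ (inj₁ (inj₂ (r , _))) = inj₂ r
      X₂⊆ (inj₂ (r , _))        = inj₂ r

      F : Pred Point 0ℓ
      F w = R w × ¬ In X₂ w

      F? : Decidable F
      F? w = R? w ×-dec ¬? (in? X₂ w)

      R⊆X₂∪F : ∀ {w} → R w → In X₂ w ⊎ F w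
      R⊆X₂∪F {w} r with in? X₂ w
      ... | yes x = inj₁ x
      ... | no ¬x = inj₂ (r , ¬x)

      -- A neighbour in `R` contradicts sparseness; a neighbour in `X` would have had `p` attached
      -- already.
      isolated-right : ∀ {p} → F p →
        ¬ (In X₂ (p ⊕ unit (clockwise d)) ⊎ F (p ⊕ unit (clockwise d)))
      isolated-right (r , ¬x) (inj₂ (r′ , _)) = sparse r r′
      isolated-right {p} (r , ¬x) (inj₁ x₂) with X₂⊆ x₂
      ... | inj₂ r′ = sparse r r′
      ... | inj₁ x  = ¬x (inj₂ (r , inj₁ (subst (λ c → In X (p ⊕ unit c))
                                     (sym (opposite-involutive (clockwise d))) x)))

      isolated-left : ∀ {p} → F (p ⊕ unit (clockwise d)) → ¬ (In X₂ p ⊎ F p)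
      isolated-left (r , ¬x) (inj₂ (r′ , _)) = sparse r′ r
      isolated-left {p} (r , ¬x) (inj₁ x₂) with X₂⊆ x₂
      ... | inj₂ r′ = sparse r′ r
      ... | inj₁ x  = ¬x (inj₁ (inj₂ (r , subst (In X) (sym (forth-back (clockwise d) p)) x)))

      module D = Doubling S root d X₂ F? (R⊆S ∘ proj₁) proj₂ isolated-right isolated-left
      open Runs F? (nodes S) (R⊆S ∘ proj₁) using (ahead-of-zero; ahead-of-suc; ahead-of≤)

      X₃⊆ : ∀ {w} → In X₃ w → D.Stage (2 ^ suc K) w
      X₃⊆ (inj₁ x) = inj₁ x
      X₃⊆ {w} (inj₂ (r , x)) with R⊆X₂∪F r
      ... | inj₁ x₂ = inj₁ x₂
      ... | inj₂ f  = inj₂ (f , ≤-trans (≤-reflexive (trans (cong (λ p → 2 ^ suc K * p)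
                        (ahead-of-zero (opposite d) w (λ f′ → proj₂ f′ x))) (*-zeroʳ (2 ^ suc K)))) z≤n)

      -- A positive position is impossible at this scale, so `w` is the bottom of its run; by
      -- `closed` the cell behind it is in `R` or `X`, and not being in `F` it is in `X₂`.
      ⊆X₃ : ∀ {w} → D.Stage (2 ^ suc K) w → In X₃ w
      ⊆X₃ (inj₁ x) = inj₁ x
      ⊆X₃ {w} (inj₂ ((r , _) , le)) = inj₂ (r , [ [ id , (λ f → ⊥-elim (¬first f)) ]′ ∘ R⊆X₂∪F , inj₁ ∘ inj₁ ]′ (closed r))
        where
        ¬first : ¬ F (w ⊕ unit (opposite d))
        ¬first f = <⇒≱ (1+m+n<2m*n (size S) _ (D.up w) 2≤size (ahead-of≤ d w) size≤2^K)
          (subst (λ p → 2 ^ suc K * p ≤ p + D.up w) (ahead-of-suc (opposite d) w f) le)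

      stage-1⊆ : ∀ {w} → D.Stage 1 w → In union w
      stage-1⊆ (inj₁ x)             = X₂⊆ x
      stage-1⊆ (inj₂ ((r , _) , _)) = inj₂ r

      ⊆stage-1 : ∀ {w} → In union w → D.Stage 1 w
      ⊆stage-1 (inj₁ x) = inj₁ (inj₁ (inj₁ x))
      ⊆stage-1 {w} (inj₂ r) with R⊆X₂∪F r
      ... | inj₁ x = inj₁ x
      ... | inj₂ f = inj₂ (f , ≤-trans (≤-reflexive (*-identityˡ (D.pos w))) (m≤m+n (D.pos w) (D.up w)))

    -- Three attachments and `suc K` doublings.
    grow-union : ∀ {t} → Grown t (In X) → Grown (K + 4 + t) (In union)
    grow-union {t} g = subst (λ n → Grown n (In union)) (time K t)
      (grown-resp stage-1⊆ ⊆stage-1 (D.double* (suc K) (grown-resp X₃⊆ ⊆X₃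
        (grow-attach X₂ d R? R⊆S (grow-attach X₁ (opposite (clockwise d)) R? R⊆S
          (grow-attach X (clockwise d) R? R⊆S g))))))
      where
      time : ∀ K t → suc K + (3 + t) ≡ K + 4 + t
      time K t = trans (sym (+-suc K (3 + t))) (sym (+-assoc K 4 t))

-- Turn depth in the spanning tree.

turn : Point → Point → Point → ℕ
turn a b c = if does (dot (b ⊖ a) (c ⊖ b) ℤ.≟ + 0) then 1 else 0

-- `turns` recurses from the front of a path, whereas a node and its parent differ at the end. The
-- short lists are separated only to let `turns` reduce.
turns-∷ʳ : ∀ xs a b c → turns (((xs ∷ʳ a) ∷ʳ b) ∷ʳ c) ≡ turns ((xs ∷ʳ a) ∷ʳ b) + turn a b c
turns-∷ʳ []               a b c = +-identityʳ (turn a b c)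
turns-∷ʳ (x ∷ [])         a b c =
  trans (cong (λ n → turn x a b + n) (turns-∷ʳ [] a b c)) (sym (+-assoc (turn x a b) _ (turn a b c)))
turns-∷ʳ (x ∷ y ∷ [])     a b c =
  trans (cong (λ n → turn x y a + n) (turns-∷ʳ (y ∷ []) a b c)) (sym (+-assoc (turn x y a) _ (turn a b c)))
turns-∷ʳ (x ∷ y ∷ z ∷ xs) a b c =
  trans (cong (λ n → turn x y z + n) (turns-∷ʳ (y ∷ z ∷ xs) a b c)) (sym (+-assoc (turn x y z) _ (turn a b c)))

turns-≤-∷ʳ : ∀ xs c → turns xs ≤ turns (xs ∷ʳ c)
turns-≤-∷ʳ []               _ = z≤n
turns-≤-∷ʳ (x ∷ [])         _ = z≤n
turns-≤-∷ʳ (x ∷ y ∷ [])     _ = z≤n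
turns-≤-∷ʳ (x ∷ y ∷ z ∷ xs) c = +-monoʳ-≤ (turn x y z) (turns-≤-∷ʳ (y ∷ z ∷ xs) c)

turn-clockwise : ∀ a b c d d′ → b ≡ a ⊕ unit d′ → c ≡ b ⊕ unit d →
  d′ ≡ clockwise d ⊎ d′ ≡ opposite (clockwise d) → turn a b c ≡ 1
turn-clockwise a b c d d′ b≡ c≡ side = trans
  (cong₂ (λ u v → if does (dot u v ℤ.≟ + 0) then 1 else 0) (difference a d′ b≡) (difference b d c≡)) (perpendicular d d′ side)
  where
  difference : ∀ p d {q} → q ≡ p ⊕ unit d → q ⊖ p ≡ unit d
  difference p d eq = trans (cong (_⊖ p) eq) ([p⊕q]⊖p≡q p (unit d))
  perpendicular : ∀ d d′ → d′ ≡ clockwise d ⊎ d′ ≡ opposite (clockwise d) →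
    (if does (dot (unit d′) (unit d) ℤ.≟ + 0) then 1 else 0) ≡ 1
  perpendicular north _ (inj₁ refl) = refl
  perpendicular north _ (inj₂ refl) = refl
  perpendicular east  _ (inj₁ refl) = refl
  perpendicular east  _ (inj₂ refl) = refl
  perpendicular south _ (inj₁ refl) = refl
  perpendicular south _ (inj₂ refl) = refl
  perpendicular west  _ (inj₁ refl) = refl
  perpendicular west  _ (inj₂ refl) = refl

length-∷ʳ : ∀ (xs : List Point) x → length (xs ∷ʳ x) ≡ suc (length xs)
length-∷ʳ []       x = refl
length-∷ʳ (_ ∷ xs) x = cong suc (length-∷ʳ xs x)

bounded : ∀ (f : Point → ℕ) xs → ∃ λ M → ∀ {x} → x ∈ xs → f x ≤ M
bounded f []       = 0 , λ ()
bounded f (x ∷ xs) with M , f≤M ← bounded f xs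
  = f x ⊔ M , λ { (here refl) → m≤m⊔n (f x) M ; (there x∈) → ≤-trans (f≤M x∈) (m≤n⊔m (f x) M) }

module Tree {S : Shape} {root : Point} (tree : SpanningTree S root) where

  open SpanningTree tree

  unsnoc : ∀ {u w} (p : Star Child u w) → (u ≡ w × vertices p ≡ w ∷ []) ⊎
    (∃ λ x → Σ (Star Child u x) λ p′ → Child x w × vertices p ≡ vertices p′ ∷ʳ w)
  unsnoc ε = inj₁ (refl , refl)
  unsnoc {u} (c ◅ p) with unsnoc p
  ... | inj₁ (refl , eq)         = inj₂ (u , ε , c , cong (u ∷_) eq)
  ... | inj₂ (x , p′ , c′ , eq) = inj₂ (x , c ◅ p′ , c′ , cong (u ∷_) eq)

  vertices-∷ʳ : ∀ {u w} (p : Star Child u w) → ∃ λ xs → vertices p ≡ xs ∷ʳ w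
  vertices-∷ʳ p with unsnoc p
  ... | inj₁ (_ , eq)          = [] , eq
  ... | inj₂ (_ , p′ , _ , eq) = vertices p′ , eq

  vertices-snoc : ∀ {u v w} (p : Star Child u v) (c : Child v w) → vertices (p ◅◅ (c ◅ ε)) ≡ vertices p ∷ʳ w
  vertices-snoc ε       c = refl
  vertices-snoc {u} (_ ◅ p) c = cong (u ∷_) (vertices-snoc p c)

  -- The endpoint determines its parent and the root is nobody's child, so both walks lose the same
  -- last vertex; `n` is the recursion measure.
  path-unique : ∀ n {w} (p q : Star Child root w) → length (vertices p) ≤ n → vertices p ≡ vertices q
  path-unique n p q p≤ with unsnoc p | unsnoc q
  ... | inj₁ (_ , eq)    | inj₁ (_ , eq′) = trans eq (sym eq′)
  ... | inj₁ (refl , _)  | inj₂ (_ , _ , (_ , ≢root , _) , _) = contradiction refl ≢root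
  ... | inj₂ (_ , _ , (_ , ≢root , _) , _) | inj₁ (refl , _) = contradiction refl ≢root
  path-unique zero    {w} p q p≤ | inj₂ (_ , p′ , _ , eq) | inj₂ _ =
    contradiction (≤-trans (≤-reflexive (sym (trans (cong length eq) (length-∷ʳ (vertices p′) w)))) p≤) n≮0
  path-unique (suc n) {w} p q p≤ | inj₂ (_ , p′ , (_ , _ , refl) , eq) | inj₂ (_ , q′ , (_ , _ , refl) , eq′) =
    trans eq (trans (cong (_∷ʳ w) (path-unique n p′ q′ p′≤)) (sym eq′))
    where
    p′≤ : length (vertices p′) ≤ n
    p′≤ = ≤-pred (≤-trans (≤-reflexive (sym (trans (cong length eq) (length-∷ʳ (vertices p′) w)))) p≤)

  unique : ∀ {w} (p q : Star Child root w) → vertices p ≡ vertices q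
  unique p q = path-unique _ p q ≤-refl

  end-node : ∀ {w} → Star Child root w → w ∈ nodes S
  end-node p with unsnoc p
  ... | inj₁ (refl , _)             = root-node
  ... | inj₂ (_ , _ , (w∈ , _) , _) = w∈

  vertices-to : Point → List Point
  vertices-to w with w ∈ₚ? nodes S
  ... | yes w∈ = vertices (path w∈)
  ... | no _   = []

  vertices-to≡ : ∀ {w} (p : Star Child root w) → vertices-to w ≡ vertices p
  vertices-to≡ {w} p with w ∈ₚ? nodes S
  ... | yes w∈ = unique (path w∈) p
  ... | no w∉  = contradiction (end-node p) w∉

  depth : Point → ℕ
  depth w = turns (vertices-to w)

  module _ {k : ℕ} (leaves≤k : ∀ {w} (p : Star Child root w) → Leaf w → turns (vertices p) ≤ k) where

    private
      M = proj₁ (bounded (length ∘ vertices-to) (nodes S))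

      length≤M : ∀ {w} (p : Star Child root w) → length (vertices p) ≤ M
      length≤M p = ≤-trans (≤-reflexive (cong length (sym (vertices-to≡ p))))
        (proj₂ (bounded (length ∘ vertices-to) (nodes S)) (end-node p))

      -- The class bounds turns only at leaves. A path not ending at a leaf is extended to a child,
      -- which cannot lower the number of turns; as `M` bounds the length of every root path, `n`
      -- runs out only after a leaf has been met.
      turns≤k : ∀ n {w} (p : Star Child root w) → M < n + length (vertices p) → turns (vertices p) ≤ k
      turns≤k zero    p M< = contradiction (length≤M p) (<⇒≱ M<)
      turns≤k (suc n) {w} p M< with Any.any? (λ x → ¬? (x ≟ₚ root) ×-dec (parent x ≟ₚ w)) (nodes S)
      ... | no ¬child = leaves≤k p (λ x (x∈ , c) → ¬child (lose x∈ c))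
      ... | yes child with x , x∈ , c ← find child = begin
        turns (vertices p)                        ≤⟨ turns-≤-∷ʳ (vertices p) x ⟩
        turns (vertices p ∷ʳ x)                   ≡⟨ cong turns (vertices-snoc p (x∈ , c)) ⟨
        turns (vertices (p ◅◅ ((x∈ , c) ◅ ε)))    ≤⟨ turns≤k n (p ◅◅ ((x∈ , c) ◅ ε)) (≤-trans M< (≤-reflexive length≡)) ⟩
        k                                         ∎
        where
        open ≤-Reasoning
        length≡ : suc n + length (vertices p) ≡ n + length (vertices (p ◅◅ ((x∈ , c) ◅ ε)))
        length≡ = trans (sym (+-suc n _)) (cong (λ m → n + m)
          (sym (trans (cong length (vertices-snoc p (x∈ , c))) (length-∷ʳ (vertices p) x))))

    depth≤k : ∀ {w} → w ∈ nodes S → depth w ≤ k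
    depth≤k w∈ = ≤-trans (≤-reflexive (cong turns (vertices-to≡ (path w∈))))
      (turns≤k (suc M) (path w∈) (m≤m+n (suc M) _))

  parent-edge : ∀ {w} → w ∈ nodes S → w ≢ root → Edge S (parent w) w
  parent-edge w∈ w≢root = child-edge (w∈ , w≢root , refl)

  parent∈ : ∀ {w} → w ∈ nodes S → w ≢ root → parent w ∈ nodes S
  parent∈ w∈ w≢root = edge-node S (parent-edge w∈ w≢root)

  last-step : ∀ {w} → w ∈ nodes S → w ≢ root → ∃ λ d → w ≡ parent w ⊕ unit d
  last-step {w} w∈ w≢root = adjacent-unit (parent w) w (edge-adj S (parent-edge w∈ w≢root))

  vertices-parent : ∀ {w} → w ∈ nodes S → w ≢ root → vertices-to w ≡ vertices-to (parent w) ∷ʳ w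
  vertices-parent {w} w∈ w≢root = begin
    vertices-to w                             ≡⟨ vertices-to≡ (p ◅◅ (c ◅ ε)) ⟩
    vertices (p ◅◅ (c ◅ ε))                   ≡⟨ vertices-snoc p c ⟩
    vertices p ∷ʳ w                           ≡⟨ cong (_∷ʳ w) (vertices-to≡ p) ⟨
    vertices-to (parent w) ∷ʳ w               ∎
    where
    open ≡-Reasoning
    c : Child (parent w) w
    c = w∈ , w≢root , refl
    p = path (parent∈ w∈ w≢root)

  module _ {w : Point} (w∈ : w ∈ nodes S) (w≢root : w ≢ root) (v≢root : parent w ≢ root) where

    private
      v = parent w
      v∈ = parent∈ w∈ w≢root

    depth-parent : depth w ≡ depth v + turn (parent v) v w
    depth-parent = begin
      turns (vertices-to w)                                ≡⟨ cong turns (trans (vertices-parent w∈ w≢root) (cong (_∷ʳ w) v≡)) ⟩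
      turns (((xs ∷ʳ parent v) ∷ʳ v) ∷ʳ w)                 ≡⟨ turns-∷ʳ xs (parent v) v w ⟩
      turns ((xs ∷ʳ parent v) ∷ʳ v) + turn (parent v) v w  ≡⟨ cong (λ l → turns l + turn (parent v) v w) v≡ ⟨
      depth v + turn (parent v) v w                        ∎
      where
      open ≡-Reasoning
      p = path (parent∈ v∈ v≢root)
      xs = proj₁ (vertices-∷ʳ p)
      v≡ : vertices-to v ≡ (xs ∷ʳ parent v) ∷ʳ v
      v≡ = trans (vertices-parent v∈ v≢root) (cong (_∷ʳ v) (trans (vertices-to≡ p) (proj₂ (vertices-∷ʳ p))))

    -- The root path of `w` has two vertices more than that of its grandparent.
    no-return : parent v ≢ w
    no-return eq = <⇒≢ (m<n+m (length (vertices-to w)) {2} (s≤s z≤n)) (begin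
      length (vertices-to w)              ≡⟨ cong length (vertices-parent w∈ w≢root) ⟩
      length (vertices-to v ∷ʳ w)         ≡⟨ length-∷ʳ (vertices-to v) w ⟩
      suc (length (vertices-to v))        ≡⟨ cong (suc ∘ length) (vertices-parent v∈ v≢root) ⟩
      suc (length (vertices-to (parent v) ∷ʳ v)) ≡⟨ cong suc (length-∷ʳ (vertices-to (parent v)) v) ⟩
      2 + length (vertices-to (parent v)) ≡⟨ cong (λ x → 2 + length (vertices-to x)) eq ⟩
      2 + length (vertices-to w)          ∎)
      where open ≡-Reasoning

    -- An entering direction opposite to `d` would make `w` its own grandparent, and a perpendicular
    -- one counts as a turn. For a straight step monotonicity of the depth suffices, because lines
    -- are cut off at depth at most `j`.
    straight-or-turn : ∀ {d} → w ≡ v ⊕ unit d →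
      (v ≡ parent v ⊕ unit d × depth v ≤ depth w) ⊎ depth v < depth w
    straight-or-turn {d} w≡ with last-step v∈ v≢root
    ... | d′ , v≡ with directions d d′
    ...   | inj₁ refl = inj₁ (v≡ , ≤-trans (m≤m+n (depth v) _) (≤-reflexive (sym depth-parent)))
    ...   | inj₂ (inj₁ refl) = contradiction
      (sym (trans w≡ (trans (cong (_⊕ unit d) v≡) (back-forth d (parent v))))) no-return
    ...   | inj₂ (inj₂ side) = inj₂ (≤-reflexive (sym (trans depth-parent
      (trans (cong (λ n → depth v + n) (turn-clockwise (parent v) v w d d′ v≡ w≡ side)) (+-comm (depth v) 1)))))

-- Column parity and the eight classes of lines.

even : ℕ → Bool
even zero    = true
even (suc n) = not (even n)

evenℤ : ℤ → Bool
evenℤ i = even ∣ i ∣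

evenℤ-suc : ∀ i → evenℤ (i ℤ.+ + 1) ≡ not (evenℤ i)
evenℤ-suc (+ n)          = cong even (+-comm n 1)
evenℤ-suc -[1+ zero ]    = refl
evenℤ-suc -[1+ suc n ]   = sym (Boolₚ.not-involutive (even (suc n)))

evenℤ-pred : ∀ i → evenℤ (i ℤ.+ -[1+ 0 ]) ≡ not (evenℤ i)
evenℤ-pred i = begin
  evenℤ j              ≡⟨ Boolₚ.not-involutive (evenℤ j) ⟨
  not (not (evenℤ j))  ≡⟨ cong not (evenℤ-suc j) ⟨
  not (evenℤ (j ℤ.+ + 1)) ≡⟨ cong (not ∘ evenℤ) (trans (ℤₚ.+-assoc i -[1+ 0 ] (+ 1)) (ℤₚ.+-identityʳ i)) ⟩
  not (evenℤ i)        ∎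
  where
  open ≡-Reasoning
  j = i ℤ.+ -[1+ 0 ]

column-parity : Direction → Point → Bool
column-parity north (x , y) = evenℤ x
column-parity east  (x , y) = evenℤ y
column-parity south (x , y) = evenℤ x
column-parity west  (x , y) = evenℤ y

column-parity-behind : ∀ d p → column-parity d (p ⊕ unit (opposite d)) ≡ column-parity d p
column-parity-behind north (x , y) = cong evenℤ (ℤₚ.+-identityʳ x)
column-parity-behind east  (x , y) = cong evenℤ (ℤₚ.+-identityʳ y)
column-parity-behind south (x , y) = cong evenℤ (ℤₚ.+-identityʳ x)
column-parity-behind west  (x , y) = cong evenℤ (ℤₚ.+-identityʳ y)

column-parity-right : ∀ d p → column-parity d (p ⊕ unit (clockwise d)) ≡ not (column-parity d p)
column-parity-right north (x , y) = evenℤ-suc x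
column-parity-right east  (x , y) = evenℤ-pred y
column-parity-right south (x , y) = evenℤ-pred x
column-parity-right west  (x , y) = evenℤ-suc y

classes : List (Direction × Bool)
classes = (north , true) ∷ (north , false) ∷ (east , true) ∷ (east , false) ∷
          (south , true) ∷ (south , false) ∷ (west , true) ∷ (west , false) ∷ []

∈-classes : ∀ d b → (d , b) ∈ classes
∈-classes north true  = here refl
∈-classes north false = there (here refl)
∈-classes east  true  = there (there (here refl))
∈-classes east  false = there (there (there (here refl)))
∈-classes south true  = there (there (there (there (here refl))))
∈-classes south false = there (there (there (there (there (here refl)))))
∈-classes west  true  = there (there (there (there (there (there (here refl))))))
∈-classes west  false = there (there (there (there (there (there (there (here refl)))))))

-- First and last shape of the process.

length≤1⇒≡ : ∀ {ps : List Point} {p q} → length ps ≤ 1 → p ∈ ps → q ∈ ps → p ≡ q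
length≤1⇒≡ _ (here refl) (here refl) = refl
length≤1⇒≡ {_ ∷ _ ∷ _} (s≤s ()) (there _) _
length≤1⇒≡ {_ ∷ _ ∷ _} (s≤s ()) (here _) (there _)

module _ (S : Shape) (root : Point) where

  open Growth S root
  open Equivalence

  grown-root : Grown 0 (_≡ root)
  grown-root = singleNode root , start , isolated , λ p → mk⇔ (λ { (here eq) → eq ; (there ()) }) here
    where
    isolated : Induced (singleNode root)
    isolated (here refl) (here refl) adj =
      let d , eq = adjacent-unit root root adj in contradiction (sym eq) (p⊕unit≢p root d)

  grown-all : ∀ {t} → Grown t (_∈ nodes S) → GrowsIn (singleNode root) t (AC S)
  grown-all (A , process , induced , nodes⇔) = root , A , here refl , process , 𝟎 ,
    (λ p → subst (λ q → p ∈ nodes A ⇔ q ∈ nodes S) (sym (⊕-identityʳ p)) (nodes⇔ p)) ,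
    (λ p q → subst₂ (λ p′ q′ → Edge A p q ⇔ Edge (AC S) p′ q′) (sym (⊕-identityʳ p)) (sym (⊕-identityʳ q))
      (mk⇔ (λ e → inj₂ (to (nodes⇔ p) (edge-node A e) , to (nodes⇔ q) (edge-node A (edge-sym A e)) , edge-adj A e))
           (λ e → induced (from (nodes⇔ p) (edge-node (AC S) e))
                    (from (nodes⇔ q) (edge-node (AC S) (edge-sym (AC S) {p} {q} e))) (edge-adj (AC S) {p} {q} e))))

  -- Treated apart because the logarithm of 1 is 0, which leaves no step to spend.
  grown-trivial : root ∈ nodes S → size S ≤ 1 → GrowsIn (singleNode root) 0 (AC S)
  grown-trivial root∈ size≤1 =
    grown-all (grown-resp (λ { refl → root∈ }) (λ p∈ → length≤1⇒≡ size≤1 p∈ root∈) grown-root)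

-- Growing the tree by turn depth.

module Phases {S : Shape} {root : Point} (tree : SpanningTree S root)
  (K : ℕ) (2≤size : 2 ≤ size S) (size≤2^K : size S ≤ 2 ^ K) where

  open SpanningTree tree using (parent; Child; Leaf; root-node)
  open Tree tree
  open Growth S root
  open Columns S root K 2≤size size≤2^K

  -- The nodes of turn depth at most j entered in direction d, in every other
  -- column (parity b), so that no two of them lie side by side.
  Line : ℕ → Direction → Bool → Pred Point 0ℓ
  Line j d b w =
    w ∈ nodes S × w ≢ root × w ≡ parent w ⊕ unit d × depth w ≤ j × column-parity d w ≡ b

  line? : ∀ j d b → Decidable (Line j d b)
  line? j d b w = (w ∈ₚ? nodes S) ×-dec (¬? (w ≟ₚ root) ×-dec ((w ≟ₚ (parent w ⊕ unit d)) ×-dec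
    ((depth w ≤? j) ×-dec (column-parity d w Boolₚ.≟ b))))

  Covers : Region → ℕ → Set
  Covers X j = ∀ {w} → w ∈ nodes S → depth w < j → In X w

  -- The cell behind `w` is its parent: the root, or a node entered in the same direction and in the
  -- same column, or a node of smaller depth, which `X` covers.
  line-closed : ∀ X {j} → Covers X j → ∀ d b {w} → Line j d b w →
    Line j d b (w ⊕ unit (opposite d)) ⊎ In X (w ⊕ unit (opposite d))
  line-closed X {j} covers d b {w} (w∈ , w≢root , w≡ , depth≤j , parity) =
    subst (λ p → Line j d b p ⊎ In X p) (sym behind≡) parent-case
    where
    v = parent w
    behind≡ : w ⊕ unit (opposite d) ≡ v
    behind≡ = trans (cong (_⊕ unit (opposite d)) w≡) (forth-back d v)
    parent-case : Line j d b v ⊎ In X v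
    parent-case with v ≟ₚ root
    ... | yes v≡root = inj₂ (subst (In X) (sym v≡root) (in-root X))
    ... | no v≢root with straight-or-turn w∈ w≢root v≢root {d} w≡
    ...   | inj₁ (v≡ , ≤depth) = inj₁ (parent∈ w∈ w≢root , v≢root , v≡ , ≤-trans ≤depth depth≤j ,
              trans (cong (column-parity d) (sym behind≡)) (trans (column-parity-behind d w) parity))
    ...   | inj₂ <depth = inj₂ (covers (parent∈ w∈ w≢root) (<-≤-trans <depth depth≤j))

  line-sparse : ∀ {j} d b {w} → Line j d b w → ¬ Line j d b (w ⊕ unit (clockwise d))
  line-sparse d b {w} (_ , _ , _ , _ , parity) (_ , _ , _ , _ , parity′) =
    Boolₚ.not-¬ refl (trans parity (trans (sym parity′) (column-parity-right d w)))

  record LinesAdded (j : ℕ) (cs : List (Direction × Bool)) (X : Region) (t : ℕ) : Set₁ where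
    constructor added
    field
      extended : Region
      grown    : Grown t (In extended)
      extends  : ∀ {w} → In X w → In extended w
      contains : ∀ {d b w} → (d , b) ∈ cs → Line j d b w → In extended w

  -- Classes are added one at a time, since sparseness holds only within a class; coverage of the
  -- smaller depths survives every enlargement of the region.
  add-lines : ∀ j cs X {t} → Covers X j → Grown t (In X) → LinesAdded j cs X (length cs * (K + 4) + t)
  add-lines j []             X     covers g = added X g id (λ ())
  add-lines j ((d , b) ∷ cs) X {t} covers g = extend (add-lines j cs X′ (λ w∈ d< → inj₁ (covers w∈ d<))
      (grow-union X d (line? j d b) proj₁ (line-closed X covers d b) (line-sparse d b) g))
    where
    X′ : Region
    X′ = union X d (line? j d b) proj₁ (line-closed X covers d b) (line-sparse d b)
    time : length cs * (K + 4) + (K + 4 + t) ≡ K + 4 + length cs * (K + 4) + t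
    time = trans (sym (+-assoc (length cs * (K + 4)) (K + 4) t))
      (cong (_+ t) (+-comm (length cs * (K + 4)) (K + 4)))
    extend : LinesAdded j cs X′ (length cs * (K + 4) + (K + 4 + t)) →
      LinesAdded j ((d , b) ∷ cs) X (suc (length cs) * (K + 4) + t)
    extend (added Y g′ X′⊆Y cs⊆Y) = added Y (subst (λ n → Grown n (In Y)) time g′) (λ x → X′⊆Y (inj₁ x))
      λ { (here refl) l → X′⊆Y (inj₂ l) ; (there c∈) l → cs⊆Y c∈ l }

  origin : Region
  origin = record
    { In      = _≡ root
    ; in?     = _≟ₚ root
    ; in-S    = λ { refl → root-node }
    ; in-root = refl
    }

  phase : ∀ j X {t} → Covers X j → Grown t (In X) →
    ∃ λ Y → Grown (8 * (K + 4) + t) (In Y) × Covers Y (suc j)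
  phase j X covers g = Y , grown , covers′
    where
    open LinesAdded (add-lines j classes X covers g) renaming (extended to Y)
    covers′ : Covers Y (suc j)
    covers′ {w} w∈ d< with w ≟ₚ root
    ... | yes refl = in-root Y
    ... | no w≢root =
      let d , w≡ = last-step w∈ w≢root
      in contains (∈-classes d (column-parity d w)) (w∈ , w≢root , w≡ , ≤-pred d< , refl)

  phases : ∀ j → ∃ λ Y → Grown (j * (8 * (K + 4))) (In Y) × Covers Y j
  phases zero    = origin , grown-root S root , λ _ ()
  phases (suc j) = let Y , g , covers = phases j in phase j Y covers g

  grown-tree : ∀ {k} →
    (∀ {w} (p : Star Child root w) → Leaf w → turns (vertices p) ≤ k) →
    GrowsIn (singleNode root) (suc k * (8 * (K + 4))) (AC S)
  grown-tree {k} leaves≤k =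
    -- Depths range over 0 to `k`, which makes `suc k` phases.
    let Y , g , covers = phases (suc k)
    in grown-all S root (grown-resp (in-S Y) (λ w∈ → covers w∈ (s≤s (depth≤k leaves≤k w∈))) g)

-- Logarithms and the constant of the bound.

n≤2^⌈log₂n⌉ : ∀ n → n ≤ 2 ^ ⌈log₂ n ⌉
n≤2^⌈log₂n⌉ = <-rec _ bound
  where
  bound : ∀ n → (∀ {m} → m < n → m ≤ 2 ^ ⌈log₂ m ⌉) → n ≤ 2 ^ ⌈log₂ n ⌉
  bound zero                rec = z≤n
  bound (suc zero)          rec = m^n>0 2 ⌈log₂ 1 ⌉
  bound n@(suc (suc m)) rec = begin
    n                                  ≡⟨ ⌊n/2⌋+⌈n/2⌉≡n n ⟨
    ⌊ n /2⌋ + ⌈ n /2⌉                  ≤⟨ +-monoˡ-≤ ⌈ n /2⌉ (⌊n/2⌋≤⌈n/2⌉ n) ⟩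
    ⌈ n /2⌉ + ⌈ n /2⌉                  ≡⟨ cong (λ k → ⌈ n /2⌉ + k) (+-identityʳ ⌈ n /2⌉) ⟨
    2 * ⌈ n /2⌉                        ≤⟨ *-monoʳ-≤ 2 (rec (⌈n/2⌉<n m)) ⟩
    2 ^ suc ⌈log₂ ⌈ n /2⌉ ⌉            ≡⟨ cong (λ k → 2 ^ suc k) (⌈log₂⌈n/2⌉⌉≡⌈log₂n⌉∸1 n) ⟩
    2 ^ (1 + (⌈log₂ n ⌉ ∸ 1))          ≡⟨ cong (2 ^_) (m+[n∸m]≡n (⌈log₂⌉-mono-≤ {2} {n} (s≤s (s≤s z≤n)))) ⟩
    2 ^ ⌈log₂ n ⌉                      ∎
    where open ≤-Reasoning

-- `suc k ≤ 2 * (k ⊔ 1)` and `K + 4 ≤ 5 * K`, so the constant is 2 · 8 · 5. The maximum with 1 is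
-- there for `k = 0`: a straight line still needs logarithmic time.
time-bound : ∀ k K → 1 ≤ K → suc k * (8 * (K + 4)) ≤ 80 * ((k ⊔ 1) * K)
time-bound k K 1≤K = begin
  suc k * (8 * (K + 4))            ≤⟨ *-mono-≤ suc-k≤ (*-monoʳ-≤ 8 (+-monoʳ-≤ K (*-monoʳ-≤ 4 1≤K))) ⟩
  (2 * (k ⊔ 1)) * (8 * (5 * K))    ≡⟨ cong (λ n → 2 * (k ⊔ 1) * n) (*-assoc 8 5 K) ⟨
  (2 * (k ⊔ 1)) * (40 * K)         ≡⟨ [m*n]*[o*p]≡[m*o]*[n*p] 2 (k ⊔ 1) 40 K ⟩
  80 * ((k ⊔ 1) * K)               ∎
  where
  open ≤-Reasoning
  suc-k≤ : suc k ≤ 2 * (k ⊔ 1)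
  suc-k≤ = ≤-trans (≤-reflexive (+-comm 1 k))
    (+-mono-≤ (m≤m⊔n k 1) (≤-trans (m≤n⊔m k 1) (m≤m+n (k ⊔ 1) 0)))

1≤⌈log₂n⌉ : ∀ {n} → 2 ≤ n → 1 ≤ ⌈log₂ n ⌉
1≤⌈log₂n⌉ {n} = ⌈log₂⌉-mono-≤ {2} {n}

grows : ∀ k S → 𝒞 k S → Dec (2 ≤ size S) →
  ∃ λ t → t ≤ 80 * ((k ⊔ 1) * ⌈log₂ size S ⌉) × ∃ λ p → GrowsIn (singleNode p) t (AC S)
grows k S (root , tree , _) (no size≱2) =
  0 , z≤n , root , grown-trivial S root (SpanningTree.root-node tree) (≤-pred (≰⇒> size≱2))
grows k S (root , tree , leaves≤k) (yes 2≤size) =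
  suc k * (8 * (⌈log₂ size S ⌉ + 4)) , time-bound k ⌈log₂ size S ⌉ (1≤⌈log₂n⌉ 2≤size) , root ,
  Phases.grown-tree tree ⌈log₂ size S ⌉ 2≤size (n≤2^⌈log₂n⌉ (size S)) leaves≤k

theorem4p1 : ∃ λ (c : ℕ) → ∀ (k : ℕ) (S : Shape) → 𝒞 k S →
    ∃ λ (t : ℕ) → t ≤ c * ((k ⊔ 1) * ⌈log₂ size S ⌉) ×
    ∃ λ (p : Point) → GrowsIn (singleNode p) t (AC S)
theorem4p1 = 80 , λ k S S∈𝒞 → grows k S S∈𝒞 (2 ≤? size S)
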